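{- Let $G$ be a connected finite simple graph with a perfect matching and $2n\geq 4$ vertices. Then $$-\tfrac{1}{2}(n^2-n-2)\leq gf(G)-Af(G)\leq (n-1)(n-2),$$ and the left-hand equality holds if and only if $n=2$.
   Context: For a perfect matching $M$ of $G$, $af(G,M)$ is the minimum size of a subset $S\subseteq E(G)\setminus M$ such that $G-S$ (delete the edges of $S$) has a unique perfect matching, and $Af(G)=\max_M af(G,M)$ over all perfect matchings. $gf(G)$ is the minimum size of an edge subset $S$ such that no two distinct perfect matchings $M_1,M_2$ of $G$ satisfy $M_1\cap S=M_2\cap S$. -}

module Defs where

open import Data.Nat using (ℕ; _≤_; _<ᵇ_)
open import Data.Bool using (Bool; true; false; _∧_; not; if_then_else_)
open import Data.Fin using (Fin; toℕ)
open import Data.List using (List; map; concatMap; allFin)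
open import Data.Nat.ListAction using (sum)
open import Data.Product using (Σ; _×_; _,_; ∃)
open import Relation.Binary.PropositionalEquality using (_≡_)

-- A (Bool-valued) symmetric relation on Fin m, used both for adjacency
-- matrices and for edge subsets (an edge {i,j} is in S iff S i j ≡ true).
Rel₂ : ℕ → Set
Rel₂ m = Fin m → Fin m → Bool

Symmetric : ∀ {m} → Rel₂ m → Set
Symmetric R = ∀ i j → R i j ≡ R j i

_⊆E_ : ∀ {m} → Rel₂ m → Rel₂ m → Set
S ⊆E T = ∀ i j → S i j ≡ true → T i j ≡ true

Disjoint : ∀ {m} → Rel₂ m → Rel₂ m → Set
Disjoint S T = ∀ i j → S i j ≡ true → T i j ≡ false

record Graph (m : ℕ) : Set where
  field
    adj   : Rel₂ m
    sym   : Symmetric adj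
    irrefl : ∀ i → adj i i ≡ false
open Graph public

data Reach {m} (A : Rel₂ m) : Fin m → Fin m → Set where
  here : ∀ {u} → Reach A u u
  step : ∀ {u w v} → A u w ≡ true → Reach A w v → Reach A u v

Connected : ∀ {m} → Graph m → Set
Connected G = ∀ u v → Reach (adj G) u v

pairs : (m : ℕ) → List (Fin m × Fin m)
pairs m = concatMap (λ i → map (λ j → (i , j)) (allFin m)) (allFin m)

size : ∀ {m} → Rel₂ m → ℕ
size {m} S = sum (map (λ { (i , j) → if (toℕ i <ᵇ toℕ j) ∧ S i j then 1 else 0 }) (pairs m))

IsPM : ∀ {m} → Rel₂ m → Rel₂ m → Set
IsPM {m} A M =
  Symmetric M × (M ⊆E A) ×
  (∀ v → Σ (Fin m) λ u → (M v u ≡ true) × (∀ w → M v w ≡ true → w ≡ u))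

HasPM : ∀ {m} → Graph m → Set
HasPM G = ∃ λ M → IsPM (adj G) M

delete : ∀ {m} → Rel₂ m → Rel₂ m → Rel₂ m
delete A S i j = A i j ∧ not (S i j)

UniquePM : ∀ {m} → Rel₂ m → Set
UniquePM A = (∃ λ M → IsPM A M) ×
  (∀ M₁ M₂ → IsPM A M₁ → IsPM A M₂ → ∀ i j → M₁ i j ≡ M₂ i j)

AfSet : ∀ {m} → Graph m → Rel₂ m → Rel₂ m → Set
AfSet G M S = Symmetric S × (S ⊆E adj G) × Disjoint S M × UniquePM (delete (adj G) S)

IsAf : ∀ {m} → Graph m → Rel₂ m → ℕ → Set
IsAf G M k = (∃ λ S → AfSet G M S × size S ≡ k) × (∀ S → AfSet G M S → k ≤ size S)

IsAfMax : ∀ {m} → Graph m → ℕ → Set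
IsAfMax G k = (∃ λ M → IsPM (adj G) M × IsAf G M k) ×
  (∀ M k' → IsPM (adj G) M → IsAf G M k' → k' ≤ k)

GfSet : ∀ {m} → Graph m → Rel₂ m → Set
GfSet G S = Symmetric S × (S ⊆E adj G) ×
  (∀ M₁ M₂ → IsPM (adj G) M₁ → IsPM (adj G) M₂ →
     (∀ i j → (M₁ i j ∧ S i j) ≡ (M₂ i j ∧ S i j)) → ∀ i j → M₁ i j ≡ M₂ i j)

IsGf : ∀ {m} → Graph m → ℕ → Set
IsGf G k = (∃ λ S → GfSet G S × size S ≡ k) × (∀ S → GfSet G S → k ≤ size S)

{-# OPTIONS --safe #-}

-- Upper bound.  Let S be an anti-forcing set, H = G − S and M the perfect matching of H.  Between two
-- edges of M there are at most two edges of H, and they share an endpoint, so one of the two M-edges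
-- "hangs" on a single vertex of the other.  Removing hanging M-edges one at a time, and each time adding
-- to S the edges of H that join the removed M-edge to all remaining ones except the one it hangs on,
-- costs at most 2(0 + 1 + … + (n − 2)) = (n − 1)(n − 2) edges and leaves nothing in which two perfect
-- matchings of G could differ: the result is a global forcing set.
--
-- Lower bound.  Let S be a global forcing set, M a perfect matching, and label one end of every M-edge
-- by A.  Some a in A has at most one edge outside S to the other side.  Otherwise a perfect matching
-- with as many edges outside S as possible has an alternating cycle entering along such edges; flipping
-- it increases that number or contradicts forcing.  Deleting all edges from a except its M-edge
-- therefore costs at most what S contains at a, and one continues with the rest.  Deleting in addition
-- the at most n(n − 1)/2 edges inside A yields an anti-forcing set of M.  Between any two M-edges some
-- pair is non-adjacent or joined by S, since otherwise two perfect matchings would avoid S; putting that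
-- pair into A saves one edge.  For n ≥ 3 three M-edges allow saving two, which gives strictness.
module Submission where

open import Defs renaming (sym to adj-sym; irrefl to adj-irrefl)
open import Data.Bool using (Bool; true; false; _∧_; _∨_; not; if_then_else_)
open import Data.Bool.Properties
  using (∧-comm; ∧-identityʳ; ∧-inverseʳ; ∧-zeroʳ; ∨-comm; ¬-not; not-involutive; ⇔→≡) renaming (_≟_ to _≟ᵇ_)
open import Data.Empty using (⊥; ⊥-elim)
open import Data.Fin using (Fin; zero; suc; toℕ; fromℕ<)
open import Data.Fin.Permutation using (permutation)
open import Data.Fin.Permutation.Components using (transpose)
open import Data.Fin.Properties using (_≟_; any?; pigeonhole; toℕ-fromℕ<; toℕ-injective; toℕ<n)
open import Data.List using (List; []; _∷_; map; concatMap; allFin; tabulate; length)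
open import Data.List.Properties using (map-tabulate; map-++; map-∘)
open import Data.List.Relation.Unary.All as All using (All; []; _∷_)
open import Data.List.Relation.Unary.AllPairs using ([]; _∷_)
open import Data.List.Relation.Unary.Unique.Propositional using (Unique)
open import Data.Nat using (ℕ; zero; suc; _+_; _*_; _∸_; _≤_; _<_; _<ᵇ_; z≤n; s≤s)
open import Data.Nat.GeneralisedArithmetic using (fold; fold-+)
import Data.Nat.ListAction as List
import Data.Nat.ListAction.Properties as List
open import Data.Nat.Properties hiding (_≟_)
open import Data.Nat.Solver using (module +-*-Solver)
open import Data.Product using (∃; ∃₂; _×_; _,_; proj₁; proj₂)
open import Data.Sum using (_⊎_; inj₁; inj₂; [_,_]′; swap)
open import Function using (_∘_; id; mk⇔)
open import Function.Bundles using (_⇔_)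
open import Relation.Binary.Definitions using (tri<; tri≈; tri>)
open import Relation.Binary.PropositionalEquality hiding ([_])
open import Relation.Nullary using (¬_; Dec; yes; no; contradiction; ¬?)
open import Relation.Nullary.Decidable using (dec-true; dec-false; ⌊_⌋; decidable-stable; _×-dec_)
open import Algebra.Properties.CommutativeMonoid.Sum +-0-commutativeMonoid
  using (sum; sum-cong-≗; ∑-distrib-+; ∑-comm; sum-permute)

-- Counting

⟦_⟧ : Bool → ℕ
⟦ b ⟧ = if b then 1 else 0

⟦⟧≤1 : ∀ b → ⟦ b ⟧ ≤ 1
⟦⟧≤1 false = z≤n
⟦⟧≤1 true  = ≤-refl

infix 7 _==_
_==_ : ∀ {m} → Fin m → Fin m → Bool
u == v = ⌊ u ≟ v ⌋

==-refl : ∀ {m} (u : Fin m) → u == u ≡ true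
==-refl u with u ≟ u
... | yes _ = refl
... | no u≢u = contradiction refl u≢u

≢⇒==-false : ∀ {m} {u v : Fin m} → u ≢ v → u == v ≡ false
≢⇒==-false {u = u} {v} u≢v with u ≟ v
... | yes u≡v = contradiction u≡v u≢v
... | no _ = refl

==⇒≡ : ∀ {m} {u v : Fin m} → u == v ≡ true → u ≡ v
==⇒≡ {u = u} {v} e with u ≟ v
... | yes u≡v = u≡v

sum-mono : ∀ {m} {f g : Fin m → ℕ} → (∀ i → f i ≤ g i) → sum f ≤ sum g
sum-mono {zero}  f≤g = z≤n
sum-mono {suc m} f≤g = +-mono-≤ (f≤g zero) (sum-mono (f≤g ∘ suc))

sum-mono-< : ∀ {m} {f g : Fin m → ℕ} → (∀ i → f i ≤ g i) → ∀ j → f j < g j → sum f < sum g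
sum-mono-< f≤g zero    f<g = +-mono-<-≤ f<g (sum-mono (f≤g ∘ suc))
sum-mono-< f≤g (suc j) f<g = +-mono-≤-< (f≤g zero) (sum-mono-< (f≤g ∘ suc) j f<g)

sum-const : ∀ m c → sum {m} (λ _ → c) ≡ m * c
sum-const zero    c = refl
sum-const (suc m) c = cong (c +_) (sum-const m c)

sum-zero : ∀ m → sum {m} (λ _ → 0) ≡ 0
sum-zero m = trans (sum-const m 0) (*-zeroʳ m)

sum-*ˡ : ∀ {m} c (f : Fin m → ℕ) → sum (λ i → c * f i) ≡ c * sum f
sum-*ˡ {zero}  c f = sym (*-zeroʳ c)
sum-*ˡ {suc m} c f = trans (cong (c * f zero +_) (sum-*ˡ c (f ∘ suc)))
                           (sym (*-distribˡ-+ c (f zero) _))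

sum-involution : ∀ {m} (σ : Fin m → Fin m) → (∀ v → σ (σ v) ≡ v) →
                 ∀ f → sum f ≡ sum (f ∘ σ)
sum-involution σ inv f = sum-permute f (permutation σ σ inv inv)

term≤sum : ∀ {m} (f : Fin m → ℕ) i → f i ≤ sum f
term≤sum f zero    = m≤m+n _ _
term≤sum f (suc i) = ≤-trans (term≤sum (f ∘ suc) i) (m≤n+m _ _)

sum-select : ∀ {m} (i : Fin m) (f : Fin m → ℕ) → sum (λ j → if j == i then f j else 0) ≡ f i
sum-select {suc m} zero f = trans (cong (f zero +_) (sum-zero m)) (+-identityʳ _)
sum-select {suc m} (suc i) f = trans (sum-cong-≗ (λ j → cong (λ b → if b then f (suc j) else 0) (lem j)))
  (sum-select i (f ∘ suc))
  where
  lem : ∀ j → suc j == suc i ≡ j == i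
  lem j with j ≟ i
  ... | yes _ = refl
  ... | no _  = refl

sum-single : ∀ {m} (i : Fin m) → sum (λ j → ⟦ j == i ⟧) ≡ 1
sum-single i = sum-select i (λ _ → 1)

sum₂ : ∀ {m} → (Fin m → Fin m → ℕ) → ℕ
sum₂ w = sum (λ i → sum (w i))

sum₂-zero : ∀ m → sum₂ {m} (λ _ _ → 0) ≡ 0
sum₂-zero m = trans (sum-cong-≗ {m} (λ _ → sum-zero m)) (sum-zero m)

sum₂-mono : ∀ {m} {w z : Fin m → Fin m → ℕ} → (∀ i j → w i j ≤ z i j) → sum₂ w ≤ sum₂ z
sum₂-mono w≤z = sum-mono (λ i → sum-mono (w≤z i))

sum₂-cong : ∀ {m} {w z : Fin m → Fin m → ℕ} → (∀ i j → w i j ≡ z i j) → sum₂ w ≡ sum₂ z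
sum₂-cong w≡z = sum-cong-≗ (λ i → sum-cong-≗ (w≡z i))

sum₂-+ : ∀ {m} (w z : Fin m → Fin m → ℕ) → sum₂ (λ i j → w i j + z i j) ≡ sum₂ w + sum₂ z
sum₂-+ w z = trans (sum-cong-≗ (λ i → ∑-distrib-+ (w i) (z i)))
                     (∑-distrib-+ (λ i → sum (w i)) (λ i → sum (z i)))

sum₂-row : ∀ {m} (i : Fin m) (w : Fin m → Fin m → ℕ) →
           sum₂ (λ j k → if j == i then w j k else 0) ≡ sum (w i)
sum₂-row i w = trans (∑-comm (λ j k → if j == i then w j k else 0))
                     (sum-cong-≗ (λ k → sum-select i (λ j → w j k)))

listSum-tabulate : ∀ {m} (f : Fin m → ℕ) → List.sum (tabulate f) ≡ sum f
listSum-tabulate {zero}  f = refl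
listSum-tabulate {suc m} f = cong (f zero +_) (listSum-tabulate (f ∘ suc))

listSum-allFin : ∀ {m} (f : Fin m → ℕ) → List.sum (map f (allFin m)) ≡ sum f
listSum-allFin f = trans (cong List.sum (map-tabulate id f)) (listSum-tabulate f)

listSum-concatMap : ∀ {A B : Set} (w : B → ℕ) (f : A → List B) xs →
  List.sum (map w (concatMap f xs)) ≡ List.sum (map (λ x → List.sum (map w (f x))) xs)
listSum-concatMap w f []       = refl
listSum-concatMap w f (x ∷ xs) =
  trans (cong List.sum (map-++ w (f x) (concatMap f xs)))
  (trans (List.sum-++ (map w (f x)) _) (cong (List.sum (map w (f x)) +_) (listSum-concatMap w f xs)))

size-sum₂ : ∀ {m} (S : Rel₂ m) → size S ≡ sum₂ (λ i j → ⟦ (toℕ i <ᵇ toℕ j) ∧ S i j ⟧)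
size-sum₂ {m} S =
  trans (listSum-concatMap w row (allFin m))
  (trans (listSum-allFin (λ i → List.sum (map w (row i))))
  (sum-cong-≗ (λ i → trans (cong List.sum (sym (map-∘ {g = w} {f = i ,_} (allFin m))))
                     (listSum-allFin (λ j → w (i , j))))))
  where
  w : Fin m × Fin m → ℕ
  w (i , j) = ⟦ (toℕ i <ᵇ toℕ j) ∧ S i j ⟧

  row : Fin m → List (Fin m × Fin m)
  row i = map (i ,_) (allFin m)

-- All counting below runs over ordered pairs, where sums can be exchanged and reindexed freely.
-- This is the bridge back to `size` and the reason for the factor 2 in front of it.
sum₂≡2*size : ∀ {m} (S : Rel₂ m) → Symmetric S → (∀ i → S i i ≡ false) →
              sum₂ (λ i j → ⟦ S i j ⟧) ≡ 2 * size S
sum₂≡2*size {m} S sym-S irr = begin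
  sum₂ (λ i j → ⟦ S i j ⟧)                  ≡⟨ sum₂-cong split ⟩
  sum₂ (λ i j → up i j + up j i)            ≡⟨ sum₂-+ up (λ i j → up j i) ⟩
  sum₂ up + sum₂ (λ i j → up j i)           ≡⟨ cong (sum₂ up +_) (∑-comm (λ i j → up j i)) ⟩
  sum₂ up + sum₂ up                         ≡⟨ cong₂ _+_ (sym (size-sum₂ S)) (trans (sym (size-sum₂ S)) (sym (+-identityʳ _))) ⟩
  2 * size S ∎
  where
  open ≡-Reasoning
  up : Fin m → Fin m → ℕ
  up i j = ⟦ (toℕ i <ᵇ toℕ j) ∧ S i j ⟧

  split : ∀ i j → ⟦ S i j ⟧ ≡ up i j + up j i
  split i j with <-cmp (toℕ i) (toℕ j)
  ... | tri< i<j _ j≮i rewrite dec-true (toℕ i <? toℕ j) i<j | dec-false (toℕ j <? toℕ i) j≮i = sym (+-identityʳ _)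
  ... | tri> i≮j _ j<i rewrite dec-false (toℕ i <? toℕ j) i≮j | dec-true (toℕ j <? toℕ i) j<i = cong ⟦_⟧ (sym-S i j)
  ... | tri≈ i≮j e j≮i rewrite dec-false (toℕ i <? toℕ j) i≮j | dec-false (toℕ j <? toℕ i) j≮i
                             | toℕ-injective e = cong ⟦_⟧ (irr j)

∧-trueˡ : ∀ {a b} → a ∧ b ≡ true → a ≡ true
∧-trueˡ {true} _ = refl

∧-trueʳ : ∀ {a b} → a ∧ b ≡ true → b ≡ true
∧-trueʳ {true} e = e

∧-true : ∀ {a b} → a ≡ true → b ≡ true → a ∧ b ≡ true
∧-true refl refl = refl

not-true : ∀ {a} → not a ≡ true → a ≡ false
not-true {false} _ = refl

true≢false : ∀ {a : Bool} {B : Set} → a ≡ true → a ≡ false → B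
true≢false refl ()

bool-ext : ∀ {a b} → (a ≡ true → b ≡ true) → (b ≡ true → a ≡ true) → a ≡ b
bool-ext f g = ⇔→≡ (mk⇔ f g)

-- Perfect matchings as fixed-point-free involutions

record Pairing (m : ℕ) : Set where
  field
    mate      : Fin m → Fin m
    mate-mate : ∀ v → mate (mate v) ≡ v
    mate-≢    : ∀ v → mate v ≢ v

  mate-swap : ∀ {u v} → mate u ≡ v → mate v ≡ u
  mate-swap {u} refl = mate-mate u

  mate-injective : ∀ {u v} → mate u ≡ mate v → u ≡ v
  mate-injective {u} {v} e = trans (sym (mate-mate u)) (trans (cong mate e) (mate-mate v))

  Apart : Fin m → Fin m → Set
  Apart u v = v ≢ u × v ≢ mate u

  apart-sym : ∀ {u v} → Apart u v → Apart v u
  apart-sym (v≢u , v≢mu) = v≢u ∘ sym , λ e → v≢mu (sym (trans (cong mate e) (mate-mate _)))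

  apart-mateˡ : ∀ {u v} → Apart u v → Apart (mate u) v
  apart-mateˡ (v≢u , v≢mu) = v≢mu , λ e → v≢u (trans e (mate-mate _))

  apart-mateʳ : ∀ {u v} → Apart u v → Apart u (mate v)
  apart-mateʳ = apart-sym ∘ apart-mateˡ ∘ apart-sym

  apart? : ∀ u v → v ≡ u ⊎ v ≡ mate u ⊎ Apart u v
  apart? u v with v ≟ u | v ≟ mate u
  ... | yes e | _     = inj₁ e
  ... | no _  | yes e = inj₂ (inj₁ e)
  ... | no ¬e | no ¬f = inj₂ (inj₂ (¬e , ¬f))

open Pairing

Within : ∀ {m} → Rel₂ m → Pairing m → Set
Within A P = ∀ v → A v (mate P v) ≡ true

matchingOf : ∀ {m} → Pairing m → Rel₂ m
matchingOf P u v = mate P u == v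

module _ {m} {A : Rel₂ m} where

  IsPM⇒Pairing : (∀ i → A i i ≡ false) → ∀ {M} → IsPM A M → Pairing m
  IsPM⇒Pairing irr {M} (M-sym , M⊆A , partner) = record
    { mate      = λ v → proj₁ (partner v)
    ; mate-mate = λ v → sym (proj₂ (proj₂ (partner _)) v (trans (M-sym _ v) (proj₁ (proj₂ (partner v)))))
    ; mate-≢    = λ v e → true≢false (M⊆A v v (subst (λ u → M v u ≡ true) e (proj₁ (proj₂ (partner v))))) (irr v)
    }

  IsPM⇒mate : ∀ irr {M} (pm : IsPM A M) {u v} → M u v ≡ true → mate (IsPM⇒Pairing irr pm) u ≡ v
  IsPM⇒mate irr (_ , _ , partner) {u} {v} Muv = sym (proj₂ (proj₂ (partner u)) v Muv)

  mate⇒IsPM : ∀ irr {M} (pm : IsPM A M) u → M u (mate (IsPM⇒Pairing irr pm) u) ≡ true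
  mate⇒IsPM irr (_ , _ , partner) u = proj₁ (proj₂ (partner u))

  IsPM⇒Within : ∀ irr {M} (pm : IsPM A M) → Within A (IsPM⇒Pairing irr pm)
  IsPM⇒Within irr pm@(_ , M⊆A , _) v = M⊆A _ _ (mate⇒IsPM irr pm v)

  Within⇒IsPM : (P : Pairing m) → Within A P → IsPM A (matchingOf P)
  Within⇒IsPM P within =
      (λ i j → bool-ext (reverse i j) (reverse j i))
    , (λ i j e → subst (λ k → A i k ≡ true) (==⇒≡ e) (within i))
    , (λ v → mate P v , ==-refl _ , λ w e → sym (==⇒≡ e))
    where
    reverse : ∀ i j → mate P i == j ≡ true → mate P j == i ≡ true
    reverse i j e = subst (λ k → mate P k == i ≡ true) (==⇒≡ e)
      (subst (λ k → k == i ≡ true) (sym (mate-mate P i)) (==-refl i))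

  IsPM-≡ : ∀ irr {M N} (pm : IsPM A M) (pn : IsPM A N) →
    (∀ v → mate (IsPM⇒Pairing irr pm) v ≡ mate (IsPM⇒Pairing irr pn) v) → ∀ i j → M i j ≡ N i j
  IsPM-≡ irr {M} {N} pm pn eq i j = bool-ext
    (λ e → subst (λ k → N i k ≡ true) (trans (sym (eq i)) (IsPM⇒mate irr pm e)) (mate⇒IsPM irr pn i))
    (λ e → subst (λ k → M i k ≡ true) (trans (eq i) (IsPM⇒mate irr pn e)) (mate⇒IsPM irr pm i))

matchingOf-≡ : ∀ {m} (P Q : Pairing m) → (∀ i j → matchingOf P i j ≡ matchingOf Q i j) →
               ∀ v → mate P v ≡ mate Q v
matchingOf-≡ P Q eq v = sym (==⇒≡ (trans (sym (eq v (mate P v))) (==-refl _)))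

UniquePM⇒mate-≡ : ∀ {m} {A : Rel₂ m} → UniquePM A → ∀ P Q → Within A P → Within A Q →
                  ∀ v → mate P v ≡ mate Q v
UniquePM⇒mate-≡ (_ , unique) P Q p q =
  matchingOf-≡ P Q (unique _ _ (Within⇒IsPM P p) (Within⇒IsPM Q q))

-- Required in both directions, this says that the two matchings have the same intersection with
-- `S`. The one-sided form can be checked edge by edge along one matching.
KeepsOn : ∀ {m} → Rel₂ m → Pairing m → Pairing m → Set
KeepsOn S P Q = ∀ v → S v (mate P v) ≡ true → mate Q v ≡ mate P v

module _ {m} (G : Graph m) {S : Rel₂ m} where

  GfSet⇒mate-≡ : GfSet G S → ∀ P Q → Within (adj G) P → Within (adj G) Q →
                 KeepsOn S P Q → KeepsOn S Q P → ∀ v → mate P v ≡ mate Q v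
  GfSet⇒mate-≡ (_ , _ , forces) P Q p q PQ QP =
    matchingOf-≡ P Q (forces _ _ (Within⇒IsPM P p) (Within⇒IsPM Q q) same)
    where
    half : ∀ P Q → KeepsOn S P Q → ∀ i j → (mate P i == j) ∧ S i j ≡ true → (mate Q i == j) ∧ S i j ≡ true
    half P Q PQ i j e with refl ← ==⇒≡ {u = mate P i} {j} (∧-trueˡ e) =
      ∧-true (trans (cong (_== mate P i) (PQ i s)) (==-refl _)) s
      where s = ∧-trueʳ {mate P i == mate P i} e

    same : ∀ i j → (mate P i == j) ∧ S i j ≡ (mate Q i == j) ∧ S i j
    same i j = bool-ext (half P Q PQ i j) (half Q P QP i j)

  mate-≡⇒GfSet : Symmetric S → S ⊆E adj G →
    (∀ P Q → Within (adj G) P → Within (adj G) Q →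
       KeepsOn S P Q → KeepsOn S Q P → ∀ v → mate P v ≡ mate Q v) →
    GfSet G S
  mate-≡⇒GfSet S-sym S⊆adj forces = S-sym , S⊆adj , λ M N pm pn same →
    IsPM-≡ irr pm pn (forces (pairing pm) (pairing pn) (IsPM⇒Within irr pm) (IsPM⇒Within irr pn)
      (keeps pm pn same) (keeps pn pm (λ i j → sym (same i j))))
    where
    irr = adj-irrefl G
    pairing : ∀ {M} → IsPM (adj G) M → Pairing m
    pairing = IsPM⇒Pairing irr

    keeps : ∀ {M N} (pm : IsPM (adj G) M) (pn : IsPM (adj G) N) →
            (∀ i j → M i j ∧ S i j ≡ N i j ∧ S i j) → KeepsOn S (pairing pm) (pairing pn)
    keeps pm pn same v s =
      IsPM⇒mate irr pn (∧-trueˡ (trans (sym (same v _)) (∧-true (mate⇒IsPM irr pm v) s)))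

-- Exchanging edges between two pairs of a matching

transpose-first : ∀ {m} (i j : Fin m) → transpose i j i ≡ j
transpose-first i j rewrite dec-true (i ≟ i) refl = refl

transpose-second : ∀ {m} (i j : Fin m) → transpose i j j ≡ i
transpose-second i j with j ≟ i
... | yes j≡i = j≡i
... | no  _ rewrite dec-true (j ≟ j) refl = refl

transpose-other : ∀ {m} (i j : Fin m) {k} → k ≢ i → k ≢ j → transpose i j k ≡ k
transpose-other i j {k} k≢i k≢j rewrite dec-false (k ≟ i) k≢i | dec-false (k ≟ j) k≢j = refl

transpose-involutive : ∀ {m} (i j k : Fin m) → transpose i j (transpose i j k) ≡ k
transpose-involutive i j k = helper (k ≟ i) (k ≟ j)
  where
  helper : Dec (k ≡ i) → Dec (k ≡ j) → transpose i j (transpose i j k) ≡ k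
  helper (yes refl) _          = trans (cong (transpose i j) (transpose-first i j)) (transpose-second i j)
  helper (no _)     (yes refl) = trans (cong (transpose i j) (transpose-second i j)) (transpose-first i j)
  helper (no k≢i)   (no k≢j)   = trans (cong (transpose i j) (transpose-other i j k≢i k≢j)) (transpose-other i j k≢i k≢j)

module _ {m} (P : Pairing m) (p q : Fin m) where
  private
    -- Conjugating `mate P` with this transposition gives a fixed-point-free involution for any `p`
    -- and `q`; only the description of its edges needs the two to be apart.
    τ : Fin m → Fin m
    τ = transpose (mate P p) q

  -- Replaces the edges p p′ and q q′ by p q and p′ q′.
  rewire : Pairing m
  rewire = record
    { mate      = λ v → τ (mate P (τ v))
    ; mate-mate = λ v → trans (cong (τ ∘ mate P) (transpose-involutive _ _ _))
                        (trans (cong τ (mate-mate P _)) (transpose-involutive _ _ v))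
    ; mate-≢    = λ v e → mate-≢ P (τ v) (trans (sym (transpose-involutive _ _ _)) (cong τ e))
    }

  module _ (ap : Apart P p q) where
    private
      q≢p : q ≢ p
      q≢p = proj₁ ap

    rewire-at : mate rewire p ≡ q
    rewire-at = trans (cong (τ ∘ mate P) (transpose-other _ _ (mate-≢ P p ∘ sym) (q≢p ∘ sym)))
                      (transpose-first (mate P p) q)

    rewire-at-mate : mate rewire (mate P p) ≡ mate P q
    rewire-at-mate = trans (cong (τ ∘ mate P) (transpose-first (mate P p) q))
                           (transpose-other _ _ (q≢p ∘ mate-injective P) (mate-≢ P q))

    rewire-other : ∀ {v} → Apart P p v → Apart P q v → mate rewire v ≡ mate P v
    rewire-other {v} (v≢p , v≢mp) (v≢q , v≢mq) =
      trans (cong (τ ∘ mate P) (transpose-other _ _ v≢mp v≢q))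
            (transpose-other _ _ (v≢p ∘ mate-injective P) (v≢mq ∘ sym ∘ mate-swap P))

    -- The one case analysis behind later claims on rewired matchings: that they lie in a given
    -- graph, or agree with another matching on `S`.
    rewire-elim : (R : Fin m → Fin m → Set) → R p q → R q p →
      R (mate P p) (mate P q) → R (mate P q) (mate P p) →
      (∀ v → Apart P p v → Apart P q v → R v (mate P v)) →
      ∀ v → R v (mate rewire v)
    rewire-elim R Rpq Rqp Rpq′ Rqp′ Rv v with apart? P p v | apart? P q v
    ... | inj₁ refl        | _ = subst (R v) (sym rewire-at) Rpq
    ... | inj₂ (inj₁ refl) | _ = subst (R v) (sym rewire-at-mate) Rpq′
    ... | inj₂ (inj₂ _)    | inj₁ refl = subst (R v) (sym (mate-swap rewire rewire-at)) Rqp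
    ... | inj₂ (inj₂ _)    | inj₂ (inj₁ refl) = subst (R v) (sym (mate-swap rewire rewire-at-mate)) Rqp′
    ... | inj₂ (inj₂ a)    | inj₂ (inj₂ b) = subst (R v) (sym (rewire-other a b)) (Rv v a b)

-- The upper bound

sumOver : ∀ {m} → (Fin m → Bool) → (Fin m → ℕ) → ℕ
sumOver R f = sum (λ v → if R v then f v else 0)

∣_∣ₛ : ∀ {m} → (Fin m → Bool) → ℕ
∣ R ∣ₛ = sumOver R (λ _ → 1)

sum-+₃ : ∀ {m} (f g h : Fin m → ℕ) → sum (λ v → f v + g v + h v) ≡ sum f + sum g + sum h
sum-+₃ f g h = trans (∑-distrib-+ (λ v → f v + g v) h) (cong (_+ sum h) (∑-distrib-+ f g))

-- Turns distinct witnesses into a lower bound. The head is split off by setting `f` to 0 there,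
-- which leaves the values on the tail untouched because the list has no repetitions.
length≤sum : ∀ {m} (f : Fin m → ℕ) {xs} → Unique xs → All (λ x → 1 ≤ f x) xs → length xs ≤ sum f
length≤sum f [] [] = z≤n
length≤sum {m} f {x ∷ xs} (x∉xs ∷ xs!) (fx ∷ fxs) = begin
  1 + length xs                                       ≤⟨ +-mono-≤ fx (length≤sum rest xs! (All.zipWith keep (x∉xs , fxs))) ⟩
  f x + sum rest                                      ≡⟨ cong (_+ sum rest) (sum-select x f) ⟨
  sum (λ v → if v == x then f v else 0) + sum rest    ≡⟨ ∑-distrib-+ (λ v → if v == x then f v else 0) rest ⟨
  sum (λ v → (if v == x then f v else 0) + rest v)    ≡⟨ sum-cong-≗ split ⟩
  sum f                                               ∎
  where
  open ≤-Reasoning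
  rest : Fin m → ℕ
  rest v = if v == x then 0 else f v

  keep : ∀ {v} → x ≢ v × 1 ≤ f v → 1 ≤ rest v
  keep (x≢v , fv) rewrite ≢⇒==-false (x≢v ∘ sym) = fv

  split : ∀ v → (if v == x then f v else 0) + rest v ≡ f v
  split v with v == x
  ... | true  = +-identityʳ (f v)
  ... | false = refl

∃-member : ∀ {m} (R : Fin m → Bool) → 1 ≤ ∣ R ∣ₛ → ∃ λ v → R v ≡ true
∃-member {m} R pos with any? (λ v → R v ≟ᵇ true)
... | yes v∈R = v∈R
... | no none = contradiction (≤-reflexive (trans (sum-cong-≗ empty) (sum-zero m))) (<⇒≱ pos)
  where
  empty : ∀ v → (if R v then 1 else 0) ≡ 0
  empty v rewrite ¬-not (none ∘ (v ,_)) = refl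

module _ {m} (P : Pairing m) where

  Closed : (Fin m → Bool) → Set
  Closed R = ∀ v → R (mate P v) ≡ R v

  remove : (Fin m → Bool) → Fin m → Fin m → Bool
  remove R u v = R v ∧ not (v == u) ∧ not (v == mate P u)

  remove-⊆ : ∀ R u v → remove R u v ≡ true → R v ≡ true
  remove-⊆ R u v = ∧-trueˡ

  remove-apart : ∀ R u v → remove R u v ≡ true → Apart P u v
  remove-apart R u v e with R v | v ≟ u | v ≟ mate P u
  ... | true | no v≢u | no v≢mu = v≢u , v≢mu

  apart⇒remove : ∀ R {u v} → R v ≡ true → Apart P u v → remove R u v ≡ true
  apart⇒remove R {u} {v} Rv (v≢u , v≢mu)
    rewrite Rv | ≢⇒==-false v≢u | ≢⇒==-false v≢mu = refl

  remove-closed : ∀ {R} u → Closed R → Closed (remove R u)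
  remove-closed {R} u closed v = bool-ext
    (λ e → apart⇒remove R (trans (sym (closed v)) (remove-⊆ R u _ e))
             (subst (Apart P u) (mate-mate P v) (apart-mateʳ P (remove-apart R u _ e))))
    (λ e → apart⇒remove R (trans (closed v) (remove-⊆ R u v e)) (apart-mateʳ P (remove-apart R u v e)))

  sumOver-remove : ∀ {R u} f → Closed R → R u ≡ true →
                   sumOver R f ≡ f u + f (mate P u) + sumOver (remove R u) f
  sumOver-remove {R} {u} f closed Ru = begin
    sumOver R f                                                    ≡⟨ sum-cong-≗ split ⟩
    sum (λ v → at u v + at (mate P u) v + rest v)                  ≡⟨ sum-+₃ (at u) (at (mate P u)) rest ⟩
    sum (at u) + sum (at (mate P u)) + sum rest
      ≡⟨ cong (_+ sum rest) (cong₂ _+_ (sum-select u f) (sum-select (mate P u) f)) ⟩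
    f u + f (mate P u) + sumOver (remove R u) f                    ∎
    where
    open ≡-Reasoning
    at : Fin m → Fin m → ℕ
    at w v = if v == w then f v else 0

    rest : Fin m → ℕ
    rest v = if remove R u v then f v else 0

    split : ∀ v → (if R v then f v else 0) ≡ at u v + at (mate P u) v + rest v
    split v with v ≟ u | v ≟ mate P u
    ... | yes refl | yes e rewrite Ru = contradiction (sym e) (mate-≢ P v)
    ... | yes refl | no _ rewrite Ru = sym (trans (+-identityʳ _) (+-identityʳ _))
    ... | no _ | yes refl rewrite trans (closed u) Ru = sym (+-identityʳ _)
    ... | no _ | no _ with R v
    ...   | true  = refl
    ...   | false = refl

  ∣remove∣ : ∀ {R u} k → Closed R → R u ≡ true → ∣ R ∣ₛ ≡ 2 * suc k → ∣ remove R u ∣ₛ ≡ 2 * k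
  ∣remove∣ {R} {u} k closed Ru e = +-cancelˡ-≡ 2 _ _
    (trans (sym (sumOver-remove (λ _ → 1) closed Ru)) (trans e (*-suc 2 k)))

∨-trueˡ : ∀ {a b} → a ≡ true → a ∨ b ≡ true
∨-trueˡ refl = refl

∨-trueʳ : ∀ a {b} → b ≡ true → a ∨ b ≡ true
∨-trueʳ true  _ = refl
∨-trueʳ false e = e

∨-true : ∀ a {b} → a ∨ b ≡ true → a ≡ true ⊎ b ≡ true
∨-true true  _ = inj₁ refl
∨-true false e = inj₂ e

true⊎false : ∀ b → b ≡ true ⊎ b ≡ false
true⊎false true  = inj₁ refl
true⊎false false = inj₂ refl

-- Removing hanging edges of a unique perfect matching

module UniqueMatching {m} (G : Graph m) {H : Rel₂ m} (H⊆G : H ⊆E adj G) (H-sym : Symmetric H)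
                      (unique : UniquePM H) where

  H-irrefl : ∀ v → H v v ≡ false
  H-irrefl v = ¬-not (λ e → true≢false (H⊆G v v e) (adj-irrefl G v))

  P : Pairing m
  P = IsPM⇒Pairing H-irrefl (proj₂ (proj₁ unique))

  P-within : Within H P
  P-within = IsPM⇒Within H-irrefl (proj₂ (proj₁ unique))

  infix 9 _′
  _′ : Fin m → Fin m
  v ′ = mate P v

  -- Two such edges could replace `u u′` and `v v′`, giving a second perfect matching of `H`.
  no-parallel : ∀ {u v} → Apart P u v → H u v ≡ true → H (u ′) (v ′) ≡ true → ⊥
  no-parallel {u} {v} ap Huv Hu′v′ = proj₂ ap (trans (sym (rewire-at P u v ap))
    (UniquePM⇒mate-≡ unique (rewire P u v) P
      (rewire-elim P u v ap (λ a b → H a b ≡ true) Huv (trans (H-sym v u) Huv) Hu′v′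
        (trans (H-sym _ _) Hu′v′) (λ w _ _ → P-within w))
      P-within u))

  -- Every H-edge from the pair of ℓ to the pair of x ends in x.
  Hangs : Fin m → Fin m → Set
  Hangs ℓ x = Apart P ℓ x × H ℓ (x ′) ≡ false × H (ℓ ′) (x ′) ≡ false

  private
    -- Once `w` is joined to both `v` and `v′`, any edge from `w′` to one of these two would be
    -- parallel to an edge at `w`.
    hangs : ∀ {u v w} → Apart P u v → H w v ≡ true → H w (v ′) ≡ true → w ≡ u ⊎ w ≡ u ′ → Hangs v w
    hangs {u} {v} ap Hwv Hwv′ (inj₁ refl) = apart-sym P ap
      , ¬-not (λ e → no-parallel (apart-mateʳ P ap) Hwv′
          (trans (H-sym _ _) (subst (λ z → H z (u ′) ≡ true) (sym (mate-mate P v)) e)))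
      , ¬-not (λ e → no-parallel ap Hwv (trans (H-sym _ _) e))
    hangs {u} {v} ap Hwv Hwv′ (inj₂ refl) = apart-sym P (apart-mateˡ P ap)
      , ¬-not (λ e → no-parallel (apart-mateˡ P (apart-mateʳ P ap)) Hwv′
          (trans (H-sym _ _) (subst (λ z → H z _ ≡ true) (sym (mate-mate P v)) e)))
      , ¬-not (λ e → no-parallel (apart-mateˡ P ap) Hwv (trans (H-sym _ _) e))

  -- By `no-parallel` at most one edge of each of `{uv, u′v′}` and `{uv′, u′v}` is present. If two
  -- edges meet in `u` or `u′`, the pair of `v` hangs there; otherwise `v` or `v′` meets none of
  -- them, and the pair of `u` hangs on the other one.
  hangs-or-hangs : ∀ {u v} → Apart P u v →
    (∃ λ x → (x ≡ v ⊎ x ≡ v ′) × Hangs u x) ⊎ (∃ λ x → (x ≡ u ⊎ x ≡ u ′) × Hangs v x)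
  hangs-or-hangs {u} {v} ap
    with true⊎false (H u v) | true⊎false (H u (v ′)) | true⊎false (H (u ′) v) | true⊎false (H (u ′) (v ′))
  ... | inj₁ a | inj₁ b | _      | _      = inj₂ (u , inj₁ refl , hangs ap a b (inj₁ refl))
  ... | _      | _      | inj₁ c | inj₁ d = inj₂ (u ′ , inj₂ refl , hangs ap c d (inj₂ refl))
  ... | inj₁ a | _      | _      | inj₁ d = ⊥-elim (no-parallel ap a d)
  ... | _      | inj₁ b | inj₁ c | _      = ⊥-elim (no-parallel (apart-mateʳ P ap) b
                                             (subst (λ z → H _ z ≡ true) (sym (mate-mate P v)) c))
  ... | _      | inj₂ b | _      | inj₂ d = inj₁ (v , inj₁ refl , ap , b , d)
  ... | inj₂ a | _      | inj₂ c | _      = inj₁ (v ′ , inj₂ refl , apart-mateʳ P ap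
      , subst (λ z → H u z ≡ false) (sym (mate-mate P v)) a
      , subst (λ z → H (u ′) z ≡ false) (sym (mate-mate P v)) c)

  free : Rel₂ m → (Fin m → Bool) → Rel₂ m
  free Z R u v = (H u v ∧ not (Z u v)) ∧ (R u ∧ R v)

  -- Two matchings that keep each other's non-free edges can differ only in free ones. They are
  -- arbitrary pairings of the vertices, so the edges outside `R` need no separate treatment in the
  -- induction.
  Forces : Rel₂ m → (Fin m → Bool) → Set
  Forces Z R = ∀ Q₁ Q₂ →
    KeepsOn (λ u v → not (free Z R u v)) Q₁ Q₂ → KeepsOn (λ u v → not (free Z R u v)) Q₂ Q₁ →
    ∀ v → mate Q₁ v ≡ mate Q₂ v

  -- Meant for `R` consisting of `k + 1` pairs. The bound stands for `k (k − 1)` edges, each counted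
  -- in both directions; for `k = 0` it is 0.
  record Forcing (R : Fin m → Bool) (k : ℕ) : Set where
    field
      Z         : Rel₂ m
      symmetric : Symmetric Z
      Z⊆H       : Z ⊆E H
      bound     : sum₂ (λ u v → ⟦ Z u v ⟧) ≤ 2 * (k * (k ∸ 1))
      forces    : Forces Z R

  free-true : ∀ Z R {u v} → free Z R u v ≡ true →
              H u v ≡ true × Z u v ≡ false × R u ≡ true × R v ≡ true
  free-true Z R {u} {v} e with H u v | Z u v | R u | R v
  ... | true | false | true | true = refl , refl , refl , refl

  differ⇒free : ∀ Z R Q₁ Q₂ {v} → KeepsOn (λ u v → not (free Z R u v)) Q₁ Q₂ →
                mate Q₁ v ≢ mate Q₂ v → free Z R v (mate Q₁ v) ≡ true
  differ⇒free Z R Q₁ Q₂ {v} keeps differ with free Z R v (mate Q₁ v) in eq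
  ... | true  = refl
  ... | false = contradiction (sym (keeps v (cong not eq))) differ

  -- A vertex where the matchings differ and its two partners would be three distinct vertices of
  -- `R`.
  forcing-pair : ∀ {R} → ∣ R ∣ₛ ≡ 2 → Forcing R 0
  forcing-pair {R} two = record
    { Z = λ _ _ → false ; symmetric = λ _ _ → refl ; Z⊆H = λ _ _ ()
    ; bound = ≤-reflexive (sum₂-zero m)
    ; forces = λ Q₁ Q₂ k₁₂ k₂₁ v → decidable-stable (_ ≟ _) (λ differ →
        let (_ , _ , Rv , R₁) = free-true (λ _ _ → false) R (differ⇒free (λ _ _ → false) R Q₁ Q₂ k₁₂ differ)
            (_ , _ , _  , R₂) = free-true (λ _ _ → false) R (differ⇒free (λ _ _ → false) R Q₂ Q₁ k₂₁ (differ ∘ sym))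
        in <⇒≱ (length≤sum (λ u → if R u then 1 else 0)
             (((mate-≢ Q₁ v ∘ sym) ∷ (mate-≢ Q₂ v ∘ sym) ∷ []) ∷ (differ ∷ []) ∷ [] ∷ [])
             (one Rv ∷ one R₁ ∷ one R₂ ∷ []))
           (≤-reflexive two))
    }
    where
    one : ∀ {u} → R u ≡ true → 1 ≤ (if R u then 1 else 0)
    one e rewrite e = ≤-refl

  module Leaf {R : Fin m → Bool} {ℓ x : Fin m} (closed : Closed P R) (Rℓ : R ℓ ≡ true) (Rx : R x ≡ true)
              (hang : Hangs ℓ x) {k : ℕ} (IH : Forcing (remove P R ℓ) k)
              (count : ∣ remove P R ℓ ∣ₛ ≡ 2 * suc k) where

    open Forcing IH renaming (Z to Z₀; symmetric to Z₀-sym; Z⊆H to Z₀⊆H; bound to Z₀-bound; forces to Z₀-forces)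

    private
      R₁ R₂ : Fin m → Bool
      R₁ = remove P R ℓ
      R₂ = remove P R₁ x

      ap : Apart P ℓ x
      ap = proj₁ hang

      R₁-closed : Closed P R₁
      R₁-closed = remove-closed P ℓ closed

      inPair : Fin m → Bool
      inPair u = (u == ℓ) ∨ (u == ℓ ′)

      N : Rel₂ m
      N u v = H u v ∧ inPair u ∧ R₂ v

      Z : Rel₂ m
      Z u v = Z₀ u v ∨ N u v ∨ N v u

    Z-sym : Symmetric Z
    Z-sym u v = cong₂ _∨_ (Z₀-sym u v) (∨-comm (N u v) (N v u))

    Z⊆H : Z ⊆E H
    Z⊆H u v e with ∨-true (Z₀ u v) e
    ... | inj₁ z = Z₀⊆H u v z
    ... | inj₂ n with ∨-true (N u v) n
    ...   | inj₁ n₁ = ∧-trueˡ n₁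
    ...   | inj₂ n₂ = trans (H-sym u v) (∧-trueˡ n₂)

    private
      w : Fin m → Fin m → ℕ
      w u v = ⟦ H u v ∧ R₂ v ⟧

      N≤ : ∀ u v → ⟦ N u v ⟧ ≤ (if u == ℓ then w u v else 0) + (if u == ℓ ′ then w u v else 0)
      N≤ u v with u ≟ ℓ | u ≟ ℓ ′
      ... | yes _ | _     = m≤m+n _ _
      ... | no _  | yes _ = ≤-refl
      ... | no _  | no _  rewrite ∧-zeroʳ (H u v) = z≤n

      -- The edges `ℓ v` and `ℓ′ v′` are parallel, so only one of them is in `H`. Shifting the
      -- second row by `mate P` therefore leaves at most one edge per vertex of `R₂`, half of the
      -- trivial count.
      w-pair : ∀ v → w ℓ v + w (ℓ ′) (v ′) ≤ (if R₂ v then 1 else 0)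
      w-pair v rewrite remove-closed P x R₁-closed v with R₂ v in eq
      ... | false rewrite ∧-zeroʳ (H ℓ v) | ∧-zeroʳ (H (ℓ ′) (v ′)) = z≤n
      ... | true with H ℓ v in e₁ | H (ℓ ′) (v ′) in e₂
      ...   | true  | true  = ⊥-elim (no-parallel (remove-apart P R ℓ v (remove-⊆ P R₁ x v eq)) e₁ e₂)
      ...   | true  | false = ≤-refl
      ...   | false | true  = ≤-refl
      ...   | false | false = z≤n

      N-bound : sum₂ (λ u v → ⟦ N u v ⟧) ≤ 2 * k
      N-bound = begin
        sum₂ (λ u v → ⟦ N u v ⟧)                          ≤⟨ sum₂-mono N≤ ⟩
        sum₂ (λ u v → at ℓ u v + at (ℓ ′) u v)            ≡⟨ sum₂-+ (at ℓ) (at (ℓ ′)) ⟩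
        sum₂ (at ℓ) + sum₂ (at (ℓ ′))                     ≡⟨ cong₂ _+_ (sum₂-row ℓ w) (sum₂-row (ℓ ′) w) ⟩
        sum (w ℓ) + sum (w (ℓ ′))
          ≡⟨ cong (sum (w ℓ) +_) (sum-involution (mate P) (mate-mate P) (w (ℓ ′))) ⟩
        sum (w ℓ) + sum (λ v → w (ℓ ′) (v ′))             ≡⟨ ∑-distrib-+ (w ℓ) (λ v → w (ℓ ′) (v ′)) ⟨
        sum (λ v → w ℓ v + w (ℓ ′) (v ′))                 ≤⟨ sum-mono w-pair ⟩
        ∣ R₂ ∣ₛ                                           ≡⟨ ∣remove∣ P k R₁-closed (apart⇒remove P R Rx ap) count ⟩
        2 * k                                             ∎
        where
        open ≤-Reasoning
        at : Fin m → Fin m → Fin m → ℕ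
        at a u v = if u == a then w u v else 0

    Z-bound : sum₂ (λ u v → ⟦ Z u v ⟧) ≤ 2 * (suc k * k)
    Z-bound = begin
      sum₂ (λ u v → ⟦ Z u v ⟧)                                   ≤⟨ sum₂-mono (λ u v → ⟦∨∨⟧ (Z₀ u v) (N u v) (N v u)) ⟩
      sum₂ (λ u v → ⟦ Z₀ u v ⟧ + (⟦ N u v ⟧ + ⟦ N v u ⟧))
        ≡⟨ sum₂-+ (λ u v → ⟦ Z₀ u v ⟧) (λ u v → ⟦ N u v ⟧ + ⟦ N v u ⟧) ⟩
      z₀ + sum₂ (λ u v → ⟦ N u v ⟧ + ⟦ N v u ⟧)
        ≡⟨ cong (z₀ +_) (sum₂-+ (λ u v → ⟦ N u v ⟧) (λ u v → ⟦ N v u ⟧)) ⟩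
      z₀ + (n + sum₂ (λ u v → ⟦ N v u ⟧))                        ≡⟨ cong (λ t → z₀ + (n + t)) (∑-comm (λ u v → ⟦ N v u ⟧)) ⟩
      z₀ + (n + n)                                               ≤⟨ +-mono-≤ Z₀-bound (+-mono-≤ N-bound N-bound) ⟩
      2 * (k * (k ∸ 1)) + (2 * k + 2 * k)                        ≡⟨ arith k ⟩
      2 * (suc k * k)                                            ∎
      where
      open ≤-Reasoning
      z₀ n : ℕ
      z₀ = sum₂ (λ u v → ⟦ Z₀ u v ⟧)
      n  = sum₂ (λ u v → ⟦ N u v ⟧)

      ⟦∨∨⟧ : ∀ a b c → ⟦ a ∨ b ∨ c ⟧ ≤ ⟦ a ⟧ + (⟦ b ⟧ + ⟦ c ⟧)
      ⟦∨∨⟧ true  b     c = s≤s z≤n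
      ⟦∨∨⟧ false true  c = s≤s z≤n
      ⟦∨∨⟧ false false c = ≤-refl

      -- The truncated `k ∸ 1` makes `k = 0` a case of its own.
      arith : ∀ k → 2 * (k * (k ∸ 1)) + (2 * k + 2 * k) ≡ 2 * (suc k * k)
      arith zero    = refl
      arith (suc k) = solve 1 (λ k → con 2 :* ((con 1 :+ k) :* k) :+ (con 2 :* (con 1 :+ k) :+ con 2 :* (con 1 :+ k))
                                 := con 2 :* ((con 2 :+ k) :* (con 1 :+ k))) refl k
        where open +-*-Solver

    inPair-true : ∀ {u} → u ≡ ℓ ⊎ u ≡ ℓ ′ → inPair u ≡ true
    inPair-true (inj₁ refl) = ∨-trueˡ (==-refl ℓ)
    inPair-true (inj₂ refl) = ∨-trueʳ (ℓ ′ == ℓ) (==-refl (ℓ ′))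

    -- Edges to third pairs were put into `N`, and `x′` is excluded because `ℓ` hangs on `x`.
    free-at-leaf : ∀ {u y} → u ≡ ℓ ⊎ u ≡ ℓ ′ → free Z R u y ≡ true → y ≡ u ′ ⊎ y ≡ x
    free-at-leaf {u} {y} u∈ e with free-true Z R e
    ... | Huy , ¬Z , _ , Ry with apart? P ℓ y
    ...   | inj₁ refl = inj₁ (other u∈)
      where
      other : u ≡ y ⊎ u ≡ y ′ → y ≡ u ′
      other (inj₁ refl) = true≢false Huy (H-irrefl u)
      other (inj₂ refl) = sym (mate-mate P y)
    ...   | inj₂ (inj₁ refl) = inj₁ (other u∈)
      where
      other : u ≡ ℓ ⊎ u ≡ ℓ ′ → ℓ ′ ≡ u ′
      other (inj₁ refl) = refl
      other (inj₂ refl) = true≢false Huy (H-irrefl u)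
    ...   | inj₂ (inj₂ apy) with apart? P x y
    ...     | inj₁ y≡x = inj₂ y≡x
    ...     | inj₂ (inj₁ refl) = true≢false Huy (none u∈)
      where
      none : u ≡ ℓ ⊎ u ≡ ℓ ′ → H u (x ′) ≡ false
      none (inj₁ refl) = proj₁ (proj₂ hang)
      none (inj₂ refl) = proj₂ (proj₂ hang)
    ...     | inj₂ (inj₂ apxy) = true≢false
      (∨-trueʳ (Z₀ u y) (∨-trueˡ (∧-true Huy (∧-true (inPair-true u∈)
        (apart⇒remove P R₁ (apart⇒remove P R Ry apy) apxy))))) ¬Z

    -- If Q₁ has the edge u u′ and Q₂ has u x, then Q₂ would need u′ x as well.
    no-switch : ∀ {Q₁ Q₂} → KeepsOn (λ u v → not (free Z R u v)) Q₂ Q₁ →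
      ∀ {u} → u ≡ ℓ ⊎ u ≡ ℓ ′ → mate Q₁ u ≡ u ′ → mate Q₂ u ≡ x → ⊥
    no-switch {Q₁} {Q₂} k₂₁ {u} u∈ Q₁u Q₂u with mate Q₁ (u ′) ≟ mate Q₂ (u ′)
    ... | yes e = proj₂ (apart-u u∈) (trans (sym Q₂u) (mate-swap Q₂ (trans (sym e) (mate-swap Q₁ Q₁u))))
      where
      apart-u : ∀ {u} → u ≡ ℓ ⊎ u ≡ ℓ ′ → Apart P u x
      apart-u (inj₁ refl) = ap
      apart-u (inj₂ refl) = apart-mateˡ P ap
    ... | no ¬e with free-at-leaf (mate-in u∈) (differ⇒free Z R Q₂ Q₁ k₂₁ (¬e ∘ sym))
      where
      mate-in : ∀ {u} → u ≡ ℓ ⊎ u ≡ ℓ ′ → u ′ ≡ ℓ ⊎ u ′ ≡ ℓ ′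
      mate-in (inj₁ refl) = inj₂ refl
      mate-in (inj₂ refl) = inj₁ (mate-mate P ℓ)
    ...   | inj₁ back = ¬e (trans (mate-swap Q₁ Q₁u) (sym (trans back (mate-mate P u))))
    ...   | inj₂ Q₂u′ = mate-≢ P u (mate-injective Q₂ (trans Q₂u′ (sym Q₂u)))

    -- If they differed at `u`, both edges there would be free, so one matching would use `u u′` and
    -- the other `u x`, which `no-switch` excludes.
    agree-at-leaf : ∀ {Q₁ Q₂} → KeepsOn (λ u v → not (free Z R u v)) Q₁ Q₂ →
      KeepsOn (λ u v → not (free Z R u v)) Q₂ Q₁ →
      ∀ {u} → u ≡ ℓ ⊎ u ≡ ℓ ′ → mate Q₁ u ≡ mate Q₂ u
    agree-at-leaf {Q₁} {Q₂} k₁₂ k₂₁ {u} u∈ with mate Q₁ u ≟ mate Q₂ u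
    ... | yes e = e
    ... | no ¬e with free-at-leaf u∈ (differ⇒free Z R Q₁ Q₂ k₁₂ ¬e) | free-at-leaf u∈ (differ⇒free Z R Q₂ Q₁ k₂₁ (¬e ∘ sym))
    ...   | inj₁ a | inj₁ b = trans a (sym b)
    ...   | inj₂ a | inj₂ b = trans a (sym b)
    ...   | inj₁ a | inj₂ b = ⊥-elim (no-switch {Q₁} {Q₂} k₂₁ u∈ a b)
    ...   | inj₂ a | inj₁ b = ⊥-elim (no-switch {Q₂} {Q₁} k₁₂ u∈ b a)

    -- An edge in which the matchings differ avoids both `ℓ` and `ℓ′` by `agree-at-leaf`, so it lies
    -- inside `R₁` and is free for the smaller set as well.
    keeps-smaller : ∀ {Q₁ Q₂} → KeepsOn (λ u v → not (free Z R u v)) Q₁ Q₂ →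
      KeepsOn (λ u v → not (free Z R u v)) Q₂ Q₁ → KeepsOn (λ u v → not (free Z₀ R₁ u v)) Q₁ Q₂
    keeps-smaller {Q₁} {Q₂} k₁₂ k₂₁ v nf with mate Q₁ v ≟ mate Q₂ v
    ... | yes e = sym e
    ... | no ¬e with free-true Z R (differ⇒free Z R Q₁ Q₂ k₁₂ ¬e)
    ...   | Hv , ¬Z , Rv , Rm = true≢false (∧-true (∧-true Hv (cong not Z₀-false)) (∧-true (inR₁ Rv v∉) (inR₁ Rm m∉)))
                                           (not-true nf)
      where
      Z₀-false : Z₀ v (mate Q₁ v) ≡ false
      Z₀-false = ¬-not (λ z → true≢false (∨-trueˡ z) ¬Z)

      v∉ : ¬ (v ≡ ℓ ⊎ v ≡ ℓ ′)
      v∉ v∈ = ¬e (agree-at-leaf {Q₁} {Q₂} k₁₂ k₂₁ v∈)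

      m∉ : ¬ (mate Q₁ v ≡ ℓ ⊎ mate Q₁ v ≡ ℓ ′)
      m∉ m∈ = ¬e (sym (mate-swap Q₂ (trans (sym (agree-at-leaf {Q₁} {Q₂} k₁₂ k₂₁ m∈)) (mate-mate Q₁ v))))

      inR₁ : ∀ {u} → R u ≡ true → ¬ (u ≡ ℓ ⊎ u ≡ ℓ ′) → R₁ u ≡ true
      inR₁ Ru u∉ = apart⇒remove P R Ru (u∉ ∘ inj₁ , u∉ ∘ inj₂)

    forcing : Forcing R (suc k)
    forcing = record
      { Z = Z ; symmetric = Z-sym ; Z⊆H = Z⊆H ; bound = Z-bound
      ; forces = λ Q₁ Q₂ k₁₂ k₂₁ → Z₀-forces Q₁ Q₂ (keeps-smaller {Q₁} {Q₂} k₁₂ k₂₁) (keeps-smaller {Q₂} {Q₁} k₂₁ k₁₂)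
      }

  forcing : ∀ k R → Closed P R → ∣ R ∣ₛ ≡ 2 * suc k → Forcing R k
  forcing zero    R closed e = forcing-pair e
  forcing (suc k) R closed e
    with ∃-member R (subst (1 ≤_) (sym e) (s≤s z≤n))
  ... | u , Ru with ∃-member (remove P R u) (subst (1 ≤_) (sym (∣remove∣ P (suc k) closed Ru e)) (s≤s z≤n))
  -- Of the two chosen pairs, the one that hangs on the other is removed.
  ...   | v , R₁v with hangs-or-hangs (remove-apart P R u v R₁v)
  ...     | inj₁ (x , x∈ , hang) = Leaf.forcing closed Ru (member x∈) hang
              (forcing k (remove P R u) (remove-closed P u closed) (∣remove∣ P (suc k) closed Ru e)) (∣remove∣ P (suc k) closed Ru e)
    where
    member : ∀ {x} → x ≡ v ⊎ x ≡ v ′ → R x ≡ true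
    member (inj₁ refl) = remove-⊆ P R u v R₁v
    member (inj₂ refl) = trans (closed v) (remove-⊆ P R u v R₁v)
  ...     | inj₂ (x , x∈ , hang) = Leaf.forcing closed Rv (member x∈) hang
              (forcing k (remove P R v) (remove-closed P v closed) (∣remove∣ P (suc k) closed Rv e)) (∣remove∣ P (suc k) closed Rv e)
    where
    Rv = remove-⊆ P R u v R₁v
    member : ∀ {x} → x ≡ u ⊎ x ≡ u ′ → R x ≡ true
    member (inj₁ refl) = Ru
    member (inj₂ refl) = trans (closed u) Ru

-- From an anti-forcing set to a global forcing set

⊆E-irrefl : ∀ {m} (G : Graph m) {S : Rel₂ m} → S ⊆E adj G → ∀ v → S v v ≡ false
⊆E-irrefl G S⊆G v = ¬-not (λ e → true≢false (S⊆G v v e) (adj-irrefl G v))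

delete-sym : ∀ {m} {A S : Rel₂ m} → Symmetric A → Symmetric S → Symmetric (delete A S)
delete-sym A-sym S-sym i j = cong₂ (λ a s → a ∧ not s) (A-sym i j) (S-sym i j)

⟦∨⟧ : ∀ a b → ⟦ a ∨ b ⟧ ≤ ⟦ a ⟧ + ⟦ b ⟧
⟦∨⟧ true  b = s≤s z≤n
⟦∨⟧ false b = ≤-refl

size-∪ : ∀ {m} (G : Graph m) {S Z : Rel₂ m} → Symmetric S → Symmetric Z → S ⊆E adj G → Z ⊆E adj G →
         2 * size (λ u v → S u v ∨ Z u v) ≤ 2 * size S + sum₂ (λ u v → ⟦ Z u v ⟧)
size-∪ G {S} {Z} S-sym Z-sym S⊆G Z⊆G = begin
  2 * size T                                  ≡⟨ sum₂≡2*size T (λ u v → cong₂ _∨_ (S-sym u v) (Z-sym u v)) (⊆E-irrefl G T⊆G) ⟨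
  sum₂ (λ u v → ⟦ T u v ⟧)                    ≤⟨ sum₂-mono (λ u v → ⟦∨⟧ (S u v) (Z u v)) ⟩
  sum₂ (λ u v → ⟦ S u v ⟧ + ⟦ Z u v ⟧)        ≡⟨ sum₂-+ (λ u v → ⟦ S u v ⟧) (λ u v → ⟦ Z u v ⟧) ⟩
  sum₂ (λ u v → ⟦ S u v ⟧) + sum₂ (λ u v → ⟦ Z u v ⟧)
    ≡⟨ cong (_+ sum₂ (λ u v → ⟦ Z u v ⟧)) (sum₂≡2*size S S-sym (⊆E-irrefl G S⊆G)) ⟩
  2 * size S + sum₂ (λ u v → ⟦ Z u v ⟧)       ∎
  where
  open ≤-Reasoning
  T : Rel₂ _
  T u v = S u v ∨ Z u v

  T⊆G : T ⊆E adj G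
  T⊆G u v e = [ S⊆G u v , Z⊆G u v ]′ (∨-true (S u v) e)

-- `S ∪ Z` is a global forcing set: an edge of `G` outside it lies in `H` and not in `Z`, so it is
-- free when `R` is the whole vertex set.
gf≤size-AfSet : ∀ {k} (G : Graph (2 * suc k)) {M S g} → AfSet G M S → IsGf G g →
                g ≤ size S + k * (k ∸ 1)
gf≤size-AfSet {k} G {M} {S} {g} (S-sym , S⊆G , _ , unique) (_ , minimal) = *-cancelˡ-≤ 2 (begin
  2 * g                                    ≤⟨ *-monoʳ-≤ 2 (minimal T T-gf) ⟩
  2 * size T                               ≤⟨ size-∪ G S-sym symmetric S⊆G (λ u v → H⊆G u v ∘ Z⊆H u v) ⟩
  2 * size S + sum₂ (λ u v → ⟦ Z u v ⟧)    ≤⟨ +-monoʳ-≤ (2 * size S) bound ⟩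
  2 * size S + 2 * (k * (k ∸ 1))           ≡⟨ *-distribˡ-+ 2 (size S) (k * (k ∸ 1)) ⟨
  2 * (size S + k * (k ∸ 1))               ∎)
  where
  open ≤-Reasoning
  H : Rel₂ (2 * suc k)
  H = delete (adj G) S

  H⊆G : H ⊆E adj G
  H⊆G u v = ∧-trueˡ

  everything : Fin (2 * suc k) → Bool
  everything _ = true

  module U = UniqueMatching G H⊆G (delete-sym (adj-sym G) S-sym) unique
  open U.Forcing (U.forcing k everything (λ _ → refl)
    (trans (sum-const (2 * suc k) 1) (*-identityʳ _)))

  T : Rel₂ (2 * suc k)
  T u v = S u v ∨ Z u v

  keeps : ∀ {Q₁ Q₂} → Within (adj G) Q₁ → KeepsOn T Q₁ Q₂ →
          KeepsOn (λ u v → not (U.free Z everything u v)) Q₁ Q₂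
  keeps {Q₁} within keepsT v nf = keepsT v (covered (within v) nf)
    where
    covered : ∀ {a s z} → a ≡ true → not (((a ∧ not s) ∧ not z) ∧ true ∧ true) ≡ true → s ∨ z ≡ true
    covered {s = true}          refl _ = refl
    covered {s = false} {true}  refl _ = refl

  T-gf : GfSet G T
  T-gf = mate-≡⇒GfSet G (λ u v → cong₂ _∨_ (S-sym u v) (symmetric u v))
    (λ u v e → [ S⊆G u v , H⊆G u v ∘ Z⊆H u v ]′ (∨-true (S u v) e))
    (λ Q₁ Q₂ in₁ in₂ k₁₂ k₂₁ → forces Q₁ Q₂ (keeps {Q₁} {Q₂} in₁ k₁₂) (keeps {Q₂} {Q₁} in₂ k₂₁))

-- Draining the edges between the two labels

⟦∧⟧-mono : ∀ {a b c} → (a ≡ true → b ≡ true → c ≡ true) → ⟦ a ∧ b ⟧ ≤ ⟦ a ∧ c ⟧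
⟦∧⟧-mono {false}        _ = z≤n
⟦∧⟧-mono {true} {false} _ = z≤n
⟦∧⟧-mono {true} {true}  h rewrite h refl refl = ≤-refl

⟦∧⟧-< : ∀ {a b c} → a ≡ true → b ≡ false → c ≡ true → ⟦ a ∧ b ⟧ < ⟦ a ∧ c ⟧
⟦∧⟧-< refl refl refl = ≤-refl

-- Periodic points of a self-map

module Periodic {m} (f : Fin m → Fin m) where

  Per : Fin m → Set
  Per v = ∃ λ (k : Fin m) → fold v f (suc (toℕ k)) ≡ v

  per? : ∀ v → Dec (Per v)
  per? v = any? (λ k → fold v f (suc (toℕ k)) ≟ v)

  fold-shift : ∀ n v → fold v f (suc n) ≡ fold (f v) f n
  fold-shift n v = trans (cong (fold v f) (+-comm 1 n)) (fold-+ v f n)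

  fold-period : ∀ p {v} → fold v f p ≡ v → ∀ n → fold v f (n * p) ≡ v
  fold-period p e zero = refl
  fold-period p {v} e (suc n) = trans (fold-+ v f p) (trans (cong (λ w → fold w f p) (fold-period p e n)) e)

  per-image : ∀ {v} → Per v → Per (f v)
  per-image {v} (k , e) = k , trans (cong f (sym (fold-shift (toℕ k) v))) (cong f e)

  per-preimage : ∀ {v} → Per v → ∃ λ u → Per u × f u ≡ v
  per-preimage {v} (k , e) = fold v f (toℕ k) , (k , back) , e
    where
    back : fold (fold v f (toℕ k)) f (suc (toℕ k)) ≡ fold v f (toℕ k)
    back = trans (sym (fold-+ v f (suc (toℕ k))))
      (trans (cong (fold v f) (+-comm (suc (toℕ k)) (toℕ k)))
      (trans (fold-+ v f (toℕ k)) (cong (λ w → fold w f (toℕ k)) e)))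

  -- The product of the two periods brings both points back to themselves. Since the orbits coincide
  -- after one step, they coincide there too; `r` is that product minus one.
  per-injective : ∀ {u v} → Per u → Per v → f u ≡ f v → u ≡ v
  per-injective {u} {v} (j , e) (k , d) fu≡fv = begin
    u                            ≡⟨ fold-period (suc (toℕ j)) e (suc (toℕ k)) ⟨
    fold u f (suc r)             ≡⟨ fold-shift r u ⟩
    fold (f u) f r               ≡⟨ cong (λ w → fold w f r) fu≡fv ⟩
    fold (f v) f r               ≡⟨ fold-shift r v ⟨
    fold v f (suc r)             ≡⟨ cong (fold v f) (*-comm (suc (toℕ k)) (suc (toℕ j))) ⟩
    fold v f (suc (toℕ j) * suc (toℕ k))  ≡⟨ fold-period (suc (toℕ k)) d (suc (toℕ j)) ⟩
    v                            ∎
    where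
    open ≡-Reasoning
    r = toℕ j + toℕ k * suc (toℕ j)

  -- Two of the first `m + 1` points of the orbit coincide; the earlier one is periodic, and the
  -- difference of their positions, `o + 1`, is a period of it.
  ∃-periodic : ∀ v → ∃ λ n → Per (fold v f n)
  ∃-periodic v with pigeonhole {m = m} ≤-refl (λ i → fold v f (toℕ i))
  ... | i , j , i<j , e with m≤n⇒∃[o]m+o≡n i<j
  ...   | o , eq = toℕ i , fromℕ< o<m , trans (cong (fold _ f ∘ suc) (toℕ-fromℕ< o<m))
            (trans (sym (fold-+ v f (suc o))) (trans (cong (fold v f) (trans (cong suc (+-comm o (toℕ i))) eq)) (sym e)))
    where
    o<m : o < m
    o<m = ≤-pred (≤-trans (s≤s (≤-trans (m≤n+m (suc o) (toℕ i)) (≤-reflexive (trans (+-suc (toℕ i) o) eq)))) (toℕ<n j))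

-- Flipping alternating cycles

module Labelled {m} (G : Graph m) (A : Fin m → Bool) {S : Rel₂ m} (gfS : GfSet G S) where

  K : Rel₂ m
  K = delete (adj G) S

  K⇒¬S : ∀ {u v} → K u v ≡ true → S u v ≡ false
  K⇒¬S {u} {v} e = not-true (∧-trueʳ {adj G u v} e)

  Neighbour : (Fin m → Bool) → Rel₂ m
  Neighbour R a b = K a b ∧ R b ∧ not (A b)

  -- The choice is made total so that it can be iterated. Outside `R ∩ A`, `choose` takes the
  -- partner in `Q`, so the walk stands still there and flipping changes nothing.
  Choice : (Fin m → Bool) → Pairing m → Fin m → Set
  Choice R Q a = ∃ λ b → A b ≡ not (A a) × R b ≡ R a × adj G a b ≡ true ×
    ((K a b ≡ true × b ≢ mate Q a) ⊎ b ≡ mate Q a × (R a ≡ true → A a ≡ true → ⊥))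

  choose : ∀ {R Q} → Within (adj G) Q → (∀ v → A (mate Q v) ≡ not (A v)) → (∀ v → R (mate Q v) ≡ R v) →
           (∀ a → R a ≡ true → A a ≡ true → ∃₂ λ b c →
              b ≢ c × Neighbour R a b ≡ true × Neighbour R a c ≡ true) →
           ∀ a → Choice R Q a
  choose {R} {Q} Q-in A-Q R-Q two a with true⊎false (R a) | true⊎false (A a)
  ... | inj₂ Ra | _       = mate Q a , A-Q a , R-Q a , Q-in a , inj₂ (refl , λ e _ → true≢false e Ra)
  ... | inj₁ _  | inj₂ Aa = mate Q a , A-Q a , R-Q a , Q-in a , inj₂ (refl , λ _ e → true≢false e Aa)
  ... | inj₁ Ra | inj₁ Aa = pick (two a Ra Aa)
    where
    take : ∀ {b} → Neighbour R a b ≡ true → b ≢ mate Q a → Choice R Q a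
    take {b} e b≢ = b , trans (not-true (∧-trueʳ {R b} RAb)) (sym (cong not Aa)) , trans (∧-trueˡ RAb) (sym Ra)
                      , ∧-trueˡ (∧-trueˡ e) , inj₁ (∧-trueˡ e , b≢)
      where RAb = ∧-trueʳ {K a b} e

    pick : (∃₂ λ b c → b ≢ c × Neighbour R a b ≡ true × Neighbour R a c ≡ true) → Choice R Q a
    pick (b , c , b≢c , Nb , Nc) with b ≟ mate Q a
    ... | no b≢  = take Nb b≢
    ... | yes b≡ = take Nc (λ c≡ → b≢c (trans b≡ (sym c≡)))

  -- For `Q` inside `G` running between the labels, this is the number of its edges outside `S`,
  -- each counted at its end in `A`. Flipping raises it.
  weight : Pairing m → ℕ
  weight Q = sum (λ v → ⟦ A v ∧ K v (mate Q v) ⟧)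

  module Flip {R : Fin m → Bool} (Q : Pairing m) (Q-in : Within (adj G) Q)
              (A-Q : ∀ v → A (mate Q v) ≡ not (A v)) (R-Q : ∀ v → R (mate Q v) ≡ R v)
              (choice : ∀ a → Choice R Q a) where

    private
      next f : Fin m → Fin m
      next a = proj₁ (choice a)
      -- A chosen edge followed by an edge of `Q` returns to the same label, so nontrivial cycles of
      -- `f` inside `A` trace alternating cycles.
      f a = mate Q (next a)

      A-next : ∀ a → A (next a) ≡ not (A a)
      A-next a = proj₁ (proj₂ (choice a))

      R-next : ∀ a → R (next a) ≡ R a
      R-next a = proj₁ (proj₂ (proj₂ (choice a)))

      adj-next : ∀ a → adj G a (next a) ≡ true
      adj-next a = proj₁ (proj₂ (proj₂ (proj₂ (choice a))))

      A-f : ∀ a → A (f a) ≡ A a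
      A-f a = trans (A-Q (next a)) (trans (cong not (A-next a)) (not-involutive (A a)))

      R-f : ∀ a → R (f a) ≡ R a
      R-f a = trans (R-Q (next a)) (R-next a)

      open Periodic f

      -- All cycles of `f` inside `A` are flipped at once: a periodic vertex of `A` moves to its
      -- chosen partner, any other vertex of `A` keeps its edge of `Q`.
      Fwd : Fin m → Fin m → Set
      Fwd v w = A v ≡ true × ((Per v × w ≡ next v) ⊎ (¬ Per v × w ≡ mate Q v))

      fwd-functional : ∀ {v w x} → Fwd v w → Fwd v x → w ≡ x
      fwd-functional (_ , inj₁ (_ , e))  (_ , inj₁ (_ , d))  = trans e (sym d)
      fwd-functional (_ , inj₂ (_ , e))  (_ , inj₂ (_ , d))  = trans e (sym d)
      fwd-functional (_ , inj₁ (p , _))  (_ , inj₂ (¬p , _)) = contradiction p ¬p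
      fwd-functional (_ , inj₂ (¬p , _)) (_ , inj₁ (p , _))  = contradiction p ¬p

      -- On periodic vertices `f` is injective. In the mixed cases the non-periodic vertex would be
      -- the `f`-image of the periodic one and hence periodic.
      fwd-injective : ∀ {v w x} → Fwd v w → Fwd x w → v ≡ x
      fwd-injective (_ , inj₁ (p , e))  (_ , inj₁ (q , d))  = per-injective p q (cong (mate Q) (trans (sym e) d))
      fwd-injective (_ , inj₂ (_ , e))  (_ , inj₂ (_ , d))  = mate-injective Q (trans (sym e) d)
      fwd-injective (_ , inj₁ (p , e))  (_ , inj₂ (¬q , d)) =
        contradiction (subst Per (trans (cong (mate Q) (trans (sym e) d)) (mate-mate Q _)) (per-image p)) ¬q
      fwd-injective (_ , inj₂ (¬p , e)) (_ , inj₁ (q , d))  =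
        contradiction (subst Per (trans (cong (mate Q) (trans (sym d) e)) (mate-mate Q _)) (per-image q)) ¬p

      fwd-label : ∀ {v w} → Fwd v w → A w ≡ not (A v)
      fwd-label {v} (_ , inj₁ (_ , refl)) = A-next v
      fwd-label {v} (_ , inj₂ (_ , refl)) = A-Q v

      fwd-clash : ∀ {v w x} {B : Set} → Fwd v w → Fwd x v → B
      fwd-clash vw xv = true≢false (proj₁ vw) (trans (fwd-label xv) (cong not (proj₁ xv)))

      Flipped : Fin m → Fin m → Set
      Flipped v w = Fwd v w ⊎ Fwd w v

      flipped-functional : ∀ {v w x} → Flipped v w → Flipped v x → w ≡ x
      flipped-functional (inj₁ a) (inj₁ b) = fwd-functional a b
      flipped-functional (inj₂ a) (inj₂ b) = fwd-injective a b
      flipped-functional (inj₁ a) (inj₂ b) = fwd-clash a b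
      flipped-functional (inj₂ a) (inj₁ b) = fwd-clash b a

      forward : ∀ v → A v ≡ true → ∃ (Fwd v)
      forward v Av with per? v
      ... | yes p = next v , Av , inj₁ (p , refl)
      ... | no ¬p = mate Q v , Av , inj₂ (¬p , refl)

      flipped : ∀ v → ∃ (Flipped v)
      flipped v with true⊎false (A v)
      ... | inj₁ Av = let (w , fw) = forward v Av in w , inj₁ fw
      ... | inj₂ Av with per? (mate Q v)
      ...   | no ¬p = mate Q v , inj₂ (trans (A-Q v) (cong not Av) , inj₂ (¬p , sym (mate-mate Q v)))
      ...   | yes p with per-preimage p
      -- The periodic predecessor `u` of `mate Q v` satisfies `next u ≡ v`, so it is the new partner
      -- of `v`.
      ...     | u , q , e = u , inj₂ (trans (sym (A-f u)) (trans (cong A e) (trans (A-Q v) (cong not Av)))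
                                     , inj₁ (q , mate-injective Q (sym e)))

    Q⁺ : Pairing m
    Q⁺ = record
      { mate      = λ v → proj₁ (flipped v)
      ; mate-mate = λ v → flipped-functional (proj₂ (flipped (proj₁ (flipped v)))) (swap (proj₂ (flipped v)))
      ; mate-≢    = λ v e → fixed (subst (Flipped v) e (proj₂ (flipped v)))
      }
      where
      fixed : ∀ {v} → Flipped v v → ⊥
      fixed (inj₁ a) = fwd-clash a a
      fixed (inj₂ a) = fwd-clash a a

    private
      fwd-elim : (B : Fin m → Fin m → Set) → (∀ v → B v (next v)) → (∀ v → B v (mate Q v)) →
                 ∀ {v w} → Fwd v w → B v w
      fwd-elim B n q {v} (_ , inj₁ (_ , refl)) = n v
      fwd-elim B n q {v} (_ , inj₂ (_ , refl)) = q v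

      flipped-elim : (B : Fin m → Fin m → Set) → (∀ {v w} → B v w → B w v) → (∀ v → B v (next v)) →
                     (∀ v → B v (mate Q v)) → ∀ v → B v (mate Q⁺ v)
      flipped-elim B B-sym n q v with flipped v
      ... | w , inj₁ a = fwd-elim B n q a
      ... | w , inj₂ a = B-sym (fwd-elim B n q a)

    Q⁺-in : Within (adj G) Q⁺
    Q⁺-in = flipped-elim (λ v w → adj G v w ≡ true) (λ {v} {w} e → trans (adj-sym G w v) e) adj-next Q-in

    A-Q⁺ : ∀ v → A (mate Q⁺ v) ≡ not (A v)
    A-Q⁺ = flipped-elim (λ v w → A w ≡ not (A v)) (λ {v} e → trans (sym (not-involutive (A v))) (cong not (sym e))) A-next A-Q

    R-Q⁺ : ∀ v → R (mate Q⁺ v) ≡ R v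
    R-Q⁺ = flipped-elim (λ v w → R w ≡ R v) sym R-next R-Q

    private
      Q⁺-at : ∀ {v} → A v ≡ true →
              (K v (mate Q⁺ v) ≡ true × mate Q⁺ v ≢ mate Q v) ⊎ mate Q⁺ v ≡ mate Q v
      Q⁺-at {v} Av with flipped v
      ... | w , inj₂ a = true≢false Av (trans (fwd-label a) (cong not (proj₁ a)))
      ... | w , inj₁ (_ , inj₂ (_ , refl)) = inj₂ refl
      ... | w , inj₁ (_ , inj₁ (p , refl)) with choice v
      ...   | _ , _ , _ , _ , inj₁ (Kv , ≢) = inj₁ (Kv , ≢)
      ...   | _ , _ , _ , _ , inj₂ (e , _)       = inj₂ e

    private
      weight-≤ : ∀ v → ⟦ A v ∧ K v (mate Q v) ⟧ ≤ ⟦ A v ∧ K v (mate Q⁺ v) ⟧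
      weight-≤ v = ⟦∧⟧-mono (λ Av Kv →
        [ proj₁ , (λ e → trans (cong (K v) e) Kv) ]′ (Q⁺-at Av))

      -- The orbit of `x` reaches a cycle and never leaves `R ∩ A`, since `f` preserves both labels.
      -- On that cycle the chosen edges differ from those of `Q`.
      moved : ∀ {x} → R x ≡ true → A x ≡ true → ∃ λ v → A v ≡ true × mate Q⁺ v ≢ mate Q v
      moved {x} Rx Ax with ∃-periodic x
      ... | n , p = fold x f n , Ay , go
        where
        along : (L : Fin m → Bool) → (∀ v → L (f v) ≡ L v) → ∀ n → L (fold x f n) ≡ L x
        along L inv zero    = refl
        along L inv (suc n) = trans (inv (fold x f n)) (along L inv n)

        Ay : A (fold x f n) ≡ true
        Ay = trans (along A A-f n) Ax

        Ry : R (fold x f n) ≡ true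
        Ry = trans (along R R-f n) Rx

        go : mate Q⁺ (fold x f n) ≢ mate Q (fold x f n)
        go e with choice (fold x f n) in eq
        ... | _ , _ , _ , _ , inj₂ (_ , ¬RA) = ¬RA Ry Ay
        ... | b , _ , _ , _ , inj₁ (_ , b≢) = b≢ (trans (sym (cong proj₁ eq))
              (trans (flipped-functional (inj₁ (Ay , inj₁ (p , refl))) (proj₂ (flipped (fold x f n)))) e))

    -- New edges always avoid `S`. If some replaced edge is in `S`, the weight grows. Otherwise `Q`
    -- and `Q⁺` have the same edges in `S` although they differ, contrary to `S` being globally
    -- forcing.
    weight-< : ∀ {x} → R x ≡ true → A x ≡ true → weight Q < weight Q⁺
    weight-< {x} Rx Ax with any? (λ v → A v ≟ᵇ true ×-dec ¬? (mate Q⁺ v ≟ mate Q v) ×-dec K v (mate Q v) ≟ᵇ false)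
    ... | yes (v , Av , ≢ , Kv) = sum-mono-< weight-≤ v gain
      where
      gain : ⟦ A v ∧ K v (mate Q v) ⟧ < ⟦ A v ∧ K v (mate Q⁺ v) ⟧
      gain with Q⁺-at Av
      ... | inj₂ e = contradiction e ≢
      ... | inj₁ (K⁺ , _) = ⟦∧⟧-< Av Kv K⁺
    ... | no none = let (v , _ , ≢) = moved Rx Ax in
                    contradiction (sym (GfSet⇒mate-≡ G gfS Q Q⁺ Q-in Q⁺-in keeps keeps⁺ v)) ≢
      where
      on-A : ∀ v → A v ≡ true → (S v (mate Q v) ≡ true ⊎ S v (mate Q⁺ v) ≡ true) → mate Q⁺ v ≡ mate Q v
      on-A v Av s with Q⁺-at Av
      ... | inj₂ e = e
      ... | inj₁ (K⁺ , ≢) with s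
      ...   | inj₂ s⁺ = true≢false s⁺ (K⇒¬S K⁺)
      ...   | inj₁ s⁻ = true≢false s⁻ (K⇒¬S (¬-not (λ Kf → none (v , Av , ≢ , Kf))))

      keeps : KeepsOn S Q Q⁺
      keeps v s = [ (λ Av → on-A v Av (inj₁ s))
        , (λ Av → mate-swap Q⁺ (trans (on-A (mate Q v) (trans (A-Q v) (cong not Av))
            (inj₁ (trans (cong (S (mate Q v)) (mate-mate Q v)) (trans (proj₁ gfS _ v) s)))) (mate-mate Q v)))
        ]′ (true⊎false (A v))

      keeps⁺ : KeepsOn S Q⁺ Q
      keeps⁺ v s = [ (λ Av → sym (on-A v Av (inj₂ s)))
        , (λ Av → mate-swap Q (trans (sym (on-A (mate Q⁺ v) (trans (A-Q⁺ v) (cong not Av))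
            (inj₂ (trans (cong (S (mate Q⁺ v)) (mate-mate Q⁺ v)) (trans (proj₁ gfS _ v) s))))) (mate-mate Q⁺ v)))
        ]′ (true⊎false (A v))

-- Vertices of low degree and the draining set

sum-⟦⟧-≤1 : ∀ {m} (g : Fin m → Bool) → (∀ b c → g b ≡ true → g c ≡ true → b ≡ c) → sum (λ v → ⟦ g v ⟧) ≤ 1
sum-⟦⟧-≤1 {m} g unique with any? (λ v → g v ≟ᵇ true)
... | no none = ≤-trans (≤-reflexive (trans (sum-cong-≗ (λ v → cong ⟦_⟧ (¬-not (none ∘ (v ,_)))))
                  (sum-zero m))) z≤n
... | yes (b , gb) = ≤-trans (sum-mono single) (≤-reflexive (sum-single b))
  where
  single : ∀ v → ⟦ g v ⟧ ≤ ⟦ v == b ⟧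
  single v with g v in gv
  ... | false = z≤n
  ... | true rewrite unique v b gv gb | ==-refl b = ≤-refl

⟦⟧-mono : ∀ {a b} → (a ≡ true → b ≡ true) → ⟦ a ⟧ ≤ ⟦ b ⟧
⟦⟧-mono {false} _ = z≤n
⟦⟧-mono {true}  h rewrite h refl = ≤-refl

module AntiForcing {m} (G : Graph m) (A : Fin m → Bool) {S : Rel₂ m} (gfS : GfSet G S)
                   (P : Pairing m) (P-in : Within (adj G) P) (A-P : ∀ v → A (mate P v) ≡ not (A v)) where

  open Labelled G A gfS

  -- If every vertex of `R ∩ A` had two neighbours, flipping could be repeated forever, each time
  -- raising the weight. The weight never exceeds `m`, so `suc m` flips are already too many.
  low-degree : ∀ {R x} → Closed P R → R x ≡ true → A x ≡ true →
    ∃ λ a → R a ≡ true × A a ≡ true × (∀ b c → Neighbour R a b ≡ true → Neighbour R a c ≡ true → b ≡ c)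
  low-degree {R} {x} closed Rx Ax with any? (λ a → R a ≟ᵇ true ×-dec A a ≟ᵇ true ×-dec ¬? (two? a))
    where
    two? : ∀ a → Dec (∃₂ λ b c → b ≢ c × Neighbour R a b ≡ true × Neighbour R a c ≡ true)
    two? a = any? (λ b → any? (λ c → ¬? (b ≟ c) ×-dec Neighbour R a b ≟ᵇ true ×-dec Neighbour R a c ≟ᵇ true))
  ... | yes (a , Ra , Aa , ¬two) = a , Ra , Aa , λ b c Nb Nc → decidable-stable (b ≟ c) (λ b≢c → ¬two (b , c , b≢c , Nb , Nc))
  ... | no none = let (Q , _ , _ , _ , m<w) = climb (suc m) in
                  contradiction (≤-trans m<w (≤-trans (sum-mono (λ v → ⟦⟧≤1 (A v ∧ K v (mate Q v))))
                    (≤-reflexive (trans (sum-const m 1) (*-identityʳ m))))) (<-irrefl refl)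
    where
    two : ∀ a → R a ≡ true → A a ≡ true → ∃₂ λ b c → b ≢ c × Neighbour R a b ≡ true × Neighbour R a c ≡ true
    two a Ra Aa = decidable-stable
      (any? (λ b → any? (λ c → ¬? (b ≟ c) ×-dec Neighbour R a b ≟ᵇ true ×-dec Neighbour R a c ≟ᵇ true)))
      (λ ¬two → none (a , Ra , Aa , ¬two))

    climb : ∀ k → ∃ λ Q → Within (adj G) Q × (∀ v → A (mate Q v) ≡ not (A v)) ×
                          (∀ v → R (mate Q v) ≡ R v) × k ≤ weight Q
    climb zero = P , P-in , A-P , closed , z≤n
    climb (suc k) with climb k
    ... | Q , Q-in , A-Q , R-Q , k≤w = F.Q⁺ , F.Q⁺-in , F.A-Q⁺ , F.R-Q⁺ , ≤-trans (s≤s k≤w) (F.weight-< Rx Ax)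
      where module F = Flip Q Q-in A-Q R-Q (choose {Q = Q} Q-in A-Q R-Q two)

  crossing : (Fin m → Bool) → Rel₂ m
  crossing R u v = S u v ∧ (A u ∧ R u) ∧ (not (A v) ∧ R v)

  -- `R` is the region where `Q` may still differ from `P`. The `Y` constructed below records an
  -- edge only in the direction leaving `A`, just as `crossing` counts an edge of `S` once.
  record Draining (R : Fin m → Bool) : Set where
    field
      Y       : Rel₂ m
      avoidsP : ∀ u → Y u (mate P u) ≡ false
      bound   : sum₂ (λ u v → ⟦ Y u v ⟧) ≤ sum₂ (λ u v → ⟦ crossing R u v ⟧)
      unique  : ∀ Q → Within (adj G) Q → (∀ v → R v ≡ false → mate Q v ≡ mate P v) →
                (∀ u → A u ≡ true → R u ≡ true → A (mate Q u) ≡ false × Y u (mate Q u) ≡ false) →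
                ∀ v → mate Q v ≡ mate P v

  module Source {R : Fin m → Bool} (closed : Closed P R) {a : Fin m} (Ra : R a ≡ true) (Aa : A a ≡ true)
                (low : ∀ b c → Neighbour R a b ≡ true → Neighbour R a c ≡ true → b ≡ c)
                (IH : Draining (remove P R a)) where

    open Draining IH renaming (Y to Y₀; avoidsP to Y₀-avoidsP; bound to Y₀-bound; unique to Y₀-unique)

    private
      a′ : Fin m
      a′ = mate P a

      R₁ : Fin m → Bool
      R₁ = remove P R a

      out : Fin m → Bool
      out v = adj G a v ∧ not (A v) ∧ R₁ v

      Y : Rel₂ m
      Y u v = Y₀ u v ∨ ((u == a) ∧ out v)

      R₁-a′ : R₁ a′ ≡ false
      R₁-a′ = ¬-not (λ e → proj₂ (remove-apart P R a a′ e) refl)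

      avoids : ∀ u → Y u (mate P u) ≡ false
      avoids u with u ≟ a
      ... | no _ rewrite Y₀-avoidsP u = refl
      ... | yes refl rewrite Y₀-avoidsP a | R₁-a′ | ∧-zeroʳ (not (A a′)) = ∧-zeroʳ _

      S-out : Fin m → ℕ
      S-out v = ⟦ S a v ∧ not (A v) ∧ R v ⟧

      -- Of the edges from a to opposite vertices of R at most one is missing from S, and a a′ is not in out.
      out-bound : sum (λ v → ⟦ out v ⟧) ≤ sum S-out
      out-bound = +-cancelʳ-≤ 1 (sum (λ v → ⟦ out v ⟧)) (sum S-out) (begin
        sum (λ v → ⟦ out v ⟧) + 1                       ≡⟨ cong (sum (λ v → ⟦ out v ⟧) +_) (sum-single a′) ⟨
        sum (λ v → ⟦ out v ⟧) + sum (λ v → ⟦ v == a′ ⟧) ≡⟨ ∑-distrib-+ (λ v → ⟦ out v ⟧) (λ v → ⟦ v == a′ ⟧) ⟨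
        sum (λ v → ⟦ out v ⟧ + ⟦ v == a′ ⟧)             ≤⟨ sum-mono pointwise ⟩
        sum (λ v → S-out v + ⟦ Neighbour R a v ⟧)       ≡⟨ ∑-distrib-+ S-out (λ v → ⟦ Neighbour R a v ⟧) ⟩
        sum S-out + sum (λ v → ⟦ Neighbour R a v ⟧)     ≤⟨ +-monoʳ-≤ (sum S-out) (sum-⟦⟧-≤1 (Neighbour R a) low) ⟩
        sum S-out + 1                                   ∎)
        where
        open ≤-Reasoning
        pointwise : ∀ v → ⟦ out v ⟧ + ⟦ v == a′ ⟧ ≤ S-out v + ⟦ Neighbour R a v ⟧
        pointwise v = cover (adj G a v) (S a v) (A v) (R v) (R₁ v) (v == a′)
          (λ e → remove-⊆ P R a v e , ≢⇒==-false (proj₂ (remove-apart P R a v e))) (at-a′ ∘ ==⇒≡)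
          where
          at-a′ : v ≡ a′ → adj G a v ≡ true × A v ≡ false × R v ≡ true
          at-a′ refl = P-in a , trans (A-P a) (cong not Aa) , trans (closed a) Ra

          cover : ∀ e s l r r₁ i → (r₁ ≡ true → r ≡ true × i ≡ false) →
            (i ≡ true → e ≡ true × l ≡ false × r ≡ true) →
            ⟦ e ∧ not l ∧ r₁ ⟧ + ⟦ i ⟧ ≤ ⟦ s ∧ not l ∧ r ⟧ + ⟦ (e ∧ not s) ∧ r ∧ not l ⟧
          cover e s l r true true h _ with () ← proj₂ (h refl)
          cover e s l r false true _ h with refl , refl , refl ← h refl with s
          ... | true  = ≤-refl
          ... | false = ≤-refl
          cover e s l r false false _ _ rewrite ∧-zeroʳ (not l) | ∧-zeroʳ e = z≤n
          cover false s l r true false _ _ = z≤n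
          cover true s true r true false _ _ = z≤n
          cover true s false r true false h _ with refl , _ ← h refl with s
          ... | true  = ≤-refl
          ... | false = ≤-refl

      -- Since `a` is not in `R₁`, the row of `a` is empty in `crossing R₁` and is available to pay
      -- for the edges deleted at `a`.
      crossing-split : ∀ u v → ⟦ crossing R₁ u v ⟧ + (if u == a then ⟦ S u v ∧ not (A v) ∧ R v ⟧ else 0) ≤ ⟦ crossing R u v ⟧
      crossing-split u v with u ≟ a
      ... | yes refl rewrite Ra | Aa | ∧-zeroʳ (S a v) = ≤-refl
      ... | no u≢a = ≤-trans (≤-reflexive (+-identityʳ _)) (⟦⟧-mono (shrink {S u v} {A u} {R u} {k = A v} (remove-⊆ P R a v)))
        where
        shrink : ∀ {s l r q k t t₁} → (t₁ ≡ true → t ≡ true) →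
          s ∧ (l ∧ r ∧ q) ∧ not k ∧ t₁ ≡ true → s ∧ (l ∧ r) ∧ not k ∧ t ≡ true
        shrink {true} {true} {true} {true} {false} h e = h e

      Y-bound : sum₂ (λ u v → ⟦ Y u v ⟧) ≤ sum₂ (λ u v → ⟦ crossing R u v ⟧)
      Y-bound = begin
        sum₂ (λ u v → ⟦ Y u v ⟧)                          ≤⟨ sum₂-mono (λ u v → Y≤ (Y₀ u v) (u == a) (out v)) ⟩
        sum₂ (λ u v → ⟦ Y₀ u v ⟧ + row u v)               ≡⟨ sum₂-+ (λ u v → ⟦ Y₀ u v ⟧) row ⟩
        sum₂ (λ u v → ⟦ Y₀ u v ⟧) + sum₂ row              ≡⟨ cong (sum₂ (λ u v → ⟦ Y₀ u v ⟧) +_) (sum₂-row a (λ _ v → ⟦ out v ⟧)) ⟩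
        sum₂ (λ u v → ⟦ Y₀ u v ⟧) + sum (λ v → ⟦ out v ⟧) ≤⟨ +-mono-≤ Y₀-bound out-bound ⟩
        sum₂ (λ u v → ⟦ crossing R₁ u v ⟧) + sum S-out
          ≡⟨ cong (sum₂ (λ u v → ⟦ crossing R₁ u v ⟧) +_) (sum₂-row a (λ u v → ⟦ S u v ∧ not (A v) ∧ R v ⟧)) ⟨
        sum₂ (λ u v → ⟦ crossing R₁ u v ⟧) + sum₂ S-row   ≡⟨ sum₂-+ (λ u v → ⟦ crossing R₁ u v ⟧) S-row ⟨
        sum₂ (λ u v → ⟦ crossing R₁ u v ⟧ + S-row u v)    ≤⟨ sum₂-mono crossing-split ⟩
        sum₂ (λ u v → ⟦ crossing R u v ⟧)                 ∎
        where
        open ≤-Reasoning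
        row S-row : Fin m → Fin m → ℕ
        row u v = if u == a then ⟦ out v ⟧ else 0
        S-row u v = if u == a then ⟦ S u v ∧ not (A v) ∧ R v ⟧ else 0

        Y≤ : ∀ y i o → ⟦ y ∨ i ∧ o ⟧ ≤ ⟦ y ⟧ + (if i then ⟦ o ⟧ else 0)
        Y≤ true  i     o = s≤s z≤n
        Y≤ false true  o = ≤-refl
        Y≤ false false o = z≤n

      Y-unique : ∀ Q → Within (adj G) Q → (∀ v → R v ≡ false → mate Q v ≡ mate P v) →
        (∀ u → A u ≡ true → R u ≡ true → A (mate Q u) ≡ false × Y u (mate Q u) ≡ false) →
        ∀ v → mate Q v ≡ mate P v
      Y-unique Q Q-in outside inside = Y₀-unique Q Q-in outside₁ inside₁
        where
        -- A partner outside `R` has `a` as its partner in `P` too. A partner inside `R` other than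
        -- `a′` would be joined to `a` by an edge of `out`, which `Q` avoids.
        Qa : mate Q a ≡ a′
        Qa with true⊎false (R (mate Q a)) | apart? P a (mate Q a)
        ... | inj₂ Rf | _ = sym (mate-swap P (sym (trans (sym (mate-mate Q a)) (outside (mate Q a) Rf))))
        ... | inj₁ _  | inj₁ e = contradiction e (mate-≢ Q a)
        ... | inj₁ _  | inj₂ (inj₁ e) = e
        ... | inj₁ Rt | inj₂ (inj₂ ap) = true≢false
          (∨-trueʳ (Y₀ a (mate Q a)) (∧-true (==-refl a) (∧-true (Q-in a)
            (∧-true (cong not (proj₁ (inside a Aa Ra))) (apart⇒remove P R Rt ap)))))
          (proj₂ (inside a Aa Ra))

        outside₁ : ∀ v → R₁ v ≡ false → mate Q v ≡ mate P v
        outside₁ v R₁v with true⊎false (R v) | apart? P a v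
        ... | inj₂ Rf | _ = outside v Rf
        ... | inj₁ _  | inj₁ refl = Qa
        ... | inj₁ _  | inj₂ (inj₁ refl) = trans (mate-swap Q Qa) (sym (mate-mate P a))
        ... | inj₁ Rt | inj₂ (inj₂ ap) = true≢false (apart⇒remove P R Rt ap) R₁v

        inside₁ : ∀ u → A u ≡ true → R₁ u ≡ true → A (mate Q u) ≡ false × Y₀ u (mate Q u) ≡ false
        inside₁ u Au R₁u = let (Af , Yf) = inside u Au (remove-⊆ P R a u R₁u) in
          Af , ¬-not (λ y → true≢false (∨-trueˡ y) Yf)

    draining : Draining R
    draining = record { Y = Y ; avoidsP = avoids ; bound = Y-bound ; unique = Y-unique }

  draining : ∀ k R → Closed P R → ∣ R ∣ₛ ≡ 2 * k → Draining R
  draining zero R closed e = record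
    { Y = λ _ _ → false ; avoidsP = λ _ → refl
    ; bound = ≤-trans (≤-reflexive (sum₂-zero m)) z≤n
    ; unique = λ Q _ outside _ v → outside v (¬-not (λ Rv → <⇒≱ (member Rv) (≤-reflexive e)))
    }
    where
    member : ∀ {v} → R v ≡ true → 0 < ∣ R ∣ₛ
    member {v} Rv = ≤-trans (≤-reflexive (sym (cong (λ b → if b then 1 else 0) Rv))) (term≤sum (λ v → if R v then 1 else 0) v)
  draining (suc k) R closed e with ∃-member R (subst (1 ≤_) (sym e) (s≤s z≤n))
  ... | u , Ru with labelled (true⊎false (A u))
    where
    labelled : A u ≡ true ⊎ A u ≡ false → ∃ λ x → R x ≡ true × A x ≡ true
    labelled (inj₁ Au) = u , Ru , Au
    labelled (inj₂ Au) = mate P u , trans (closed u) Ru , trans (A-P u) (cong not Au)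
  ...   | x , Rx , Ax with low-degree closed Rx Ax
  ...     | a , Ra , Aa , low = Source.draining closed Ra Aa low
              (draining k (remove P R a) (remove-closed P a closed) (∣remove∣ P k closed Ra e))

-- The lower bound

Labelling : ∀ {m} → Pairing m → (Fin m → Bool) → Set
Labelling P A = ∀ v → A (mate P v) ≡ not (A v)

module _ n (P : Pairing (2 * n)) {A : Fin (2 * n) → Bool} (A-P : Labelling P A) where

  -- A vertex and its mate together carry one label, so adding the count to its reindexing along
  -- `mate P` gives 1 at every vertex.
  ∣labelled∣ : sum (λ v → ⟦ A v ⟧) ≡ n
  ∣labelled∣ = *-cancelˡ-≡ _ n 2 (begin
    2 * sum a                                  ≡⟨ cong (sum a +_) (+-identityʳ _) ⟩
    sum a + sum a                              ≡⟨ cong (sum a +_) (sum-involution (mate P) (mate-mate P) a) ⟩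
    sum a + sum (a ∘ mate P)                   ≡⟨ ∑-distrib-+ a (a ∘ mate P) ⟨
    sum (λ v → a v + a (mate P v))             ≡⟨ sum-cong-≗ (λ v → trans (cong (λ b → ⟦ A v ⟧ + ⟦ b ⟧) (A-P v)) (complement (A v))) ⟩
    sum {2 * n} (λ _ → 1)                      ≡⟨ sum-const (2 * n) 1 ⟩
    2 * n * 1                                  ≡⟨ *-identityʳ (2 * n) ⟩
    2 * n                                      ∎)
    where
    open ≡-Reasoning
    a : Fin (2 * n) → ℕ
    a v = ⟦ A v ⟧

    complement : ∀ b → ⟦ b ⟧ + ⟦ not b ⟧ ≡ 1
    complement true  = refl
    complement false = refl

  sum₂-labelled : sum₂ (λ u v → ⟦ A u ∧ A v ⟧) ≡ n * n
  sum₂-labelled = begin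
    sum₂ (λ u v → ⟦ A u ∧ A v ⟧)          ≡⟨ sum₂-cong (λ u v → ⟦∧⟧ (A u) (A v)) ⟩
    sum₂ (λ u v → ⟦ A u ⟧ * ⟦ A v ⟧)      ≡⟨ sum-cong-≗ (λ u → sum-*ˡ ⟦ A u ⟧ (λ v → ⟦ A v ⟧)) ⟩
    sum (λ u → ⟦ A u ⟧ * a)               ≡⟨ sum-cong-≗ (λ u → *-comm ⟦ A u ⟧ a) ⟩
    sum (λ u → a * ⟦ A u ⟧)               ≡⟨ sum-*ˡ a (λ u → ⟦ A u ⟧) ⟩
    a * a                                 ≡⟨ cong₂ _*_ ∣labelled∣ ∣labelled∣ ⟩
    n * n                                 ∎
    where
    open ≡-Reasoning
    a = sum (λ v → ⟦ A v ⟧)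

    ⟦∧⟧ : ∀ b c → ⟦ b ∧ c ⟧ ≡ ⟦ b ⟧ * ⟦ c ⟧
    ⟦∧⟧ false _ = refl
    ⟦∧⟧ true  c = sym (+-identityʳ ⟦ c ⟧)

  sum₂-diagonal : sum₂ (λ u v → if v == u then ⟦ A v ⟧ else 0) ≡ n
  sum₂-diagonal = trans (sum-cong-≗ (λ u → sum-select u (λ v → ⟦ A v ⟧))) ∣labelled∣

-- Each pair counted here is an edge inside A that need not be deleted, or one already paid for by S.
saved : ∀ {m} → Graph m → Rel₂ m → (Fin m → Bool) → Fin m → Fin m → ℕ
saved G S A u v = ⟦ (A u ∧ A v) ∧ not (v == u) ∧ not (delete (adj G) S u v) ⟧

module _ {n} (G : Graph (2 * n)) {M : Rel₂ (2 * n)} (M-pm : IsPM (adj G) M)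
         {S : Rel₂ (2 * n)} (gfS : GfSet G S) where

  private
    m = 2 * n
    irr = adj-irrefl G

    P : Pairing m
    P = IsPM⇒Pairing irr M-pm

    P-in : Within (adj G) P
    P-in = IsPM⇒Within irr M-pm

  -- With A made independent, every perfect matching runs between the two labels, and Y drains those edges.
  ∃-AfSet : ∀ {A} → Labelling P A →
            ∃ λ D → AfSet G M D × 2 * size D + sum₂ (saved G S A) + n ≤ 2 * size S + n * n
  ∃-AfSet {A} A-P = D , (D-sym , D⊆G , D-disjoint , D-unique) , D-bound
    where
    open AntiForcing G A gfS P P-in A-P using (crossing; module Draining; draining)
    everything : Fin m → Bool
    everything _ = true

    open Draining (draining n everything (λ _ → refl) (trans (sum-const m 1) (*-identityʳ m)))

    D : Rel₂ m
    D u v = adj G u v ∧ ((A u ∧ A v) ∨ Y u v ∨ Y v u)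

    D-sym : Symmetric D
    D-sym u v = cong₂ _∧_ (adj-sym G u v) (cong₂ _∨_ (∧-comm (A u) (A v)) (∨-comm (Y u v) (Y v u)))

    D⊆G : D ⊆E adj G
    D⊆G u v = ∧-trueˡ

    D-avoidsP : ∀ u → D u (mate P u) ≡ false
    D-avoidsP u rewrite A-P u | avoidsP u
      | trans (cong (Y (mate P u)) (sym (mate-mate P u))) (avoidsP (mate P u)) =
      trans (cong (λ b → adj G u (mate P u) ∧ (b ∨ false)) (∧-inverseʳ (A u))) (∧-zeroʳ _)

    D-disjoint : Disjoint D M
    D-disjoint u v Duv = ¬-not (λ Muv → true≢false Duv
      (trans (cong (D u) (sym (IsPM⇒mate irr M-pm Muv))) (D-avoidsP u)))

    H : Rel₂ m
    H = delete (adj G) D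

    P-inH : Within H P
    P-inH u rewrite D-avoidsP u = trans (∧-identityʳ _) (P-in u)

    inH⇒P : ∀ Q → Within H Q → ∀ v → mate Q v ≡ mate P v
    inH⇒P Q Q-in = unique Q (λ v → ∧-trueˡ (Q-in v)) (λ _ ()) (λ u Au _ →
      split (adj G u (mate Q u)) (A u) (A (mate Q u)) (Y u (mate Q u)) Au (Q-in u))
      where
      split : ∀ e a b y {z} → a ≡ true → e ∧ not (e ∧ ((a ∧ b) ∨ y ∨ z)) ≡ true → b ≡ false × y ≡ false
      split true true false false _ _ = refl , refl

    H-irr : ∀ v → H v v ≡ false
    H-irr v rewrite irr v = refl

    D-unique : UniquePM H
    D-unique = (matchingOf P , Within⇒IsPM P P-inH) , λ M₁ M₂ p₁ p₂ → IsPM-≡ H-irr p₁ p₂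
      (λ v → trans (inH⇒P (IsPM⇒Pairing H-irr p₁) (IsPM⇒Within H-irr p₁) v)
                   (sym (inH⇒P (IsPM⇒Pairing H-irr p₂) (IsPM⇒Within H-irr p₂) v)))

    e c d : Fin m → Fin m → ℕ
    e u v = ⟦ adj G u v ∧ (A u ∧ A v) ⟧
    c u v = ⟦ crossing everything u v ⟧
    d u v = if v == u then ⟦ A v ⟧ else 0

    D≤ : ∀ u v → ⟦ D u v ⟧ ≤ e u v + (⟦ Y u v ⟧ + ⟦ Y v u ⟧)
    D≤ u v = bool (adj G u v) (A u ∧ A v) (Y u v) (Y v u)
      where
      bool : ∀ e a y z → ⟦ e ∧ (a ∨ y ∨ z) ⟧ ≤ ⟦ e ∧ a ⟧ + (⟦ y ⟧ + ⟦ z ⟧)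
      bool false a     y     z = z≤n
      bool true  true  y     z = s≤s z≤n
      bool true  false true  z = s≤s z≤n
      bool true  false false z = ≤-refl

    -- Two vertices of `A` provide one unit: it pays for deleting an edge or, if they are not
    -- adjacent, for a saving; for an edge of `S` the extra unit from `S` pays for the saving.
    -- Between the labels, a crossing edge is paid for by `S`. The diagonal of `A × A` accounts for
    -- `d`.
    pointwise : ∀ u v → e u v + (c u v + c v u) + saved G S A u v + d u v ≤ ⟦ S u v ⟧ + ⟦ A u ∧ A v ⟧
    pointwise u v rewrite proj₁ gfS v u with v ≟ u
    ... | yes refl rewrite irr u | ⊆E-irrefl G (proj₁ (proj₂ gfS)) u with A u
    ...   | true  = ≤-refl
    ...   | false = z≤n
    pointwise u v | no _ = bool (adj G u v) (S u v) (A u) (A v)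
      where
      bool : ∀ e s a b → ⟦ e ∧ (a ∧ b) ⟧ + (⟦ s ∧ (a ∧ true) ∧ (not b ∧ true) ⟧ + ⟦ s ∧ (b ∧ true) ∧ (not a ∧ true) ⟧)
             + ⟦ (a ∧ b) ∧ true ∧ not (e ∧ not s) ⟧ + 0 ≤ ⟦ s ⟧ + ⟦ a ∧ b ⟧
      bool true  true  true  true  = ≤-refl
      bool true  false true  true  = ≤-refl
      bool false true  true  true  = s≤s z≤n
      bool false false true  true  = ≤-refl
      bool true  true  true  false = ≤-refl
      bool true  false true  false = ≤-refl
      bool false true  true  false = ≤-refl
      bool false false true  false = ≤-refl
      bool true  true  false true  = ≤-refl
      bool true  false false true  = ≤-refl
      bool false true  false true  = ≤-refl
      bool false false false true  = ≤-refl
      bool true  true  false false = z≤n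
      bool true  false false false = z≤n
      bool false true  false false = z≤n
      bool false false false false = z≤n

    D-bound : 2 * size D + sum₂ (saved G S A) + n ≤ 2 * size S + n * n
    D-bound = begin
      2 * size D + h + n
        ≡⟨ cong (λ t → t + h + n) (sum₂≡2*size D D-sym (⊆E-irrefl G D⊆G)) ⟨
      sum₂ (λ u v → ⟦ D u v ⟧) + h + n
        ≤⟨ +-monoˡ-≤ n (+-monoˡ-≤ h (sum₂-mono D≤)) ⟩
      sum₂ (λ u v → e u v + (⟦ Y u v ⟧ + ⟦ Y v u ⟧)) + h + n
        ≡⟨ cong (λ t → t + h + n) (sum₂-transpose (λ u v → ⟦ Y u v ⟧)) ⟩
      sum₂ e + (y + y) + h + n
        ≤⟨ +-monoˡ-≤ n (+-monoˡ-≤ h (+-monoʳ-≤ (sum₂ e) (+-mono-≤ bound bound))) ⟩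
      sum₂ e + (sum₂ c + sum₂ c) + h + n
        ≡⟨ cong₂ (λ t k → t + h + k) (sum₂-transpose c) (sum₂-diagonal n P A-P) ⟨
      sum₂ (λ u v → e u v + (c u v + c v u)) + h + sum₂ d
        ≡⟨ trans (sum₂-+ (λ u v → e u v + (c u v + c v u) + saved G S A u v) d)
                 (cong (_+ sum₂ d) (sum₂-+ (λ u v → e u v + (c u v + c v u)) (saved G S A))) ⟨
      sum₂ (λ u v → e u v + (c u v + c v u) + saved G S A u v + d u v)
        ≤⟨ sum₂-mono pointwise ⟩
      sum₂ (λ u v → ⟦ S u v ⟧ + ⟦ A u ∧ A v ⟧)
        ≡⟨ sum₂-+ (λ u v → ⟦ S u v ⟧) (λ u v → ⟦ A u ∧ A v ⟧) ⟩
      sum₂ (λ u v → ⟦ S u v ⟧) + sum₂ (λ u v → ⟦ A u ∧ A v ⟧)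
        ≡⟨ cong₂ _+_ (sum₂≡2*size S (proj₁ gfS) (⊆E-irrefl G (proj₁ (proj₂ gfS)))) (sum₂-labelled n P A-P) ⟩
      2 * size S + n * n ∎
      where
      open ≤-Reasoning
      h y : ℕ
      h = sum₂ (saved G S A)
      y = sum₂ (λ u v → ⟦ Y u v ⟧)

      sum₂-transpose : ∀ w → sum₂ (λ u v → e u v + (w u v + w v u)) ≡ sum₂ e + (sum₂ w + sum₂ w)
      sum₂-transpose w = trans (sum₂-+ e (λ u v → w u v + w v u))
        (cong (sum₂ e +_) (trans (sum₂-+ w (λ u v → w v u)) (cong (sum₂ w +_) (∑-comm (λ u v → w v u)))))

-- Labellings through given vertices, and exchanges among three pairs

module _ {m} (P : Pairing m) where

  lower : Fin m → Bool
  lower v = toℕ v <ᵇ toℕ (mate P v)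

  lower-labelling : Labelling P lower
  lower-labelling v rewrite mate-mate P v with <-cmp (toℕ v) (toℕ (mate P v))
  ... | tri< v<v′ _ v′≮v rewrite dec-true (toℕ v <? toℕ (mate P v)) v<v′ | dec-false (toℕ (mate P v) <? toℕ v) v′≮v = refl
  ... | tri> v≮v′ _ v′<v rewrite dec-false (toℕ v <? toℕ (mate P v)) v≮v′ | dec-true (toℕ (mate P v) <? toℕ v) v′<v = refl
  ... | tri≈ _ e _ = contradiction (sym (toℕ-injective e)) (mate-≢ P v)

  promote : (Fin m → Bool) → Fin m → Fin m → Bool
  promote A u v = if v == u then true else if v == mate P u then false else A v

  module _ (A : Fin m → Bool) (u : Fin m) where

    promote-at : promote A u u ≡ true
    promote-at rewrite ==-refl u = refl

    promote-apart : ∀ {v} → Apart P u v → promote A u v ≡ A v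
    promote-apart (v≢u , v≢mu) rewrite ≢⇒==-false v≢u | ≢⇒==-false v≢mu = refl

    promote-mate : promote A u (mate P u) ≡ false
    promote-mate rewrite ≢⇒==-false (mate-≢ P u) | ==-refl (mate P u) = refl

    promote-labelling : Labelling P A → Labelling P (promote A u)
    promote-labelling A-P v with apart? P u v
    ... | inj₁ refl        = trans promote-mate (sym (cong not promote-at))
    ... | inj₂ (inj₁ refl) = trans (cong (promote A u) (mate-mate P u))
                                   (trans promote-at (sym (cong not promote-mate)))
    ... | inj₂ (inj₂ ap)   = trans (promote-apart (apart-mateʳ P ap))
                                   (trans (A-P v) (sym (cong not (promote-apart ap))))

  ∃-labelling₂ : ∀ {u v} → Apart P u v → ∃ λ A → Labelling P A × A u ≡ true × A v ≡ true
  ∃-labelling₂ {u} {v} uv = promote (promote lower u) v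
    , promote-labelling _ v (promote-labelling _ u lower-labelling)
    , trans (promote-apart (promote lower u) v (apart-sym P uv)) (promote-at lower u)
    , promote-at (promote lower u) v

  ∃-labelling₃ : ∀ {u v w} → Apart P u v → Apart P u w → Apart P v w →
                 ∃ λ A → Labelling P A × A u ≡ true × A v ≡ true × A w ≡ true
  ∃-labelling₃ {u} {v} {w} uv uw vw = let (A , A-P , Au , Av) = ∃-labelling₂ uv in
      promote A w
    , promote-labelling A w A-P
    , trans (promote-apart A w (apart-sym P uw)) Au
    , trans (promote-apart A w (apart-sym P vw)) Av
    , promote-at A w

  module _ {a b c : Fin m} (ab : Apart P a b) (ac : Apart P a c) (bc : Apart P b c) where

    private
      P₁ : Pairing m
      P₁ = rewire P a b

      P₁-b′ : mate P₁ (mate P b) ≡ mate P a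
      P₁-b′ = mate-swap P₁ (rewire-at-mate P a b ab)

      P₁-c : mate P₁ c ≡ mate P c
      P₁-c = rewire-other P a b ab ac bc

      b′c : Apart P₁ (mate P b) c
      b′c = proj₂ bc , λ e → proj₂ ac (trans e P₁-b′)

      apart₁ : ∀ {v} → Apart P a v → Apart P b v → Apart P c v → Apart P₁ (mate P b) v × Apart P₁ c v
      apart₁ (_ , v≢a′) (_ , v≢b′) (v≢c , v≢c′) =
        (v≢b′ , λ e → v≢a′ (trans e P₁-b′)) , (v≢c , λ e → v≢c′ (trans e P₁-c))

    -- Replaces the edges a a′, b b′, c c′ by a b, b′ c, a′ c′.
    hexagon : Pairing m
    hexagon = rewire P₁ (mate P b) c

    hexagon-at : mate hexagon a ≡ b
    hexagon-at = trans (rewire-other P₁ (mate P b) c b′c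
        ((λ e → proj₂ (apart-sym P ab) e) , λ e → mate-≢ P a (sym (trans e P₁-b′)))
        (proj₁ (apart-sym P ac) , λ e → proj₂ (apart-sym P ac) (trans e P₁-c)))
      (rewire-at P a b ab)

    hexagon-other : ∀ {v} → Apart P a v → Apart P b v → Apart P c v → mate hexagon v ≡ mate P v
    hexagon-other av bv cv = let (b′v , cv₁) = apart₁ av bv cv in
      trans (rewire-other P₁ (mate P b) c b′c b′v cv₁) (rewire-other P a b ab av bv)

    hexagon-elim : (R : Fin m → Fin m → Set) → (∀ {u v} → R u v → R v u) →
      R a b → R (mate P b) c → R (mate P a) (mate P c) →
      (∀ v → Apart P a v → Apart P b v → Apart P c v → R v (mate P v)) →
      ∀ v → R v (mate hexagon v)
    hexagon-elim R R-sym Rab Rb′c Ra′c′ Rv = rewire-elim P₁ (mate P b) c b′c R Rb′c (R-sym Rb′c)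
      (subst₂ R (sym P₁-b′) (sym P₁-c) Ra′c′) (R-sym (subst₂ R (sym P₁-b′) (sym P₁-c) Ra′c′))
      -- The motive also assumes `v` apart, in `P₁`, from the two pairs rewired second. This
      -- discards the intermediate edge `a′ b′`, for which nothing is known about `R`.
      (rewire-elim P a b ab (λ v w → Apart P₁ (mate P b) v → Apart P₁ c v → R v w)
        (λ _ _ → Rab) (λ _ _ → R-sym Rab)
        (λ b′a′ _ → contradiction (sym P₁-b′) (proj₂ b′a′))
        (λ b′b′ _ → contradiction refl (proj₁ b′b′))
        (λ v av bv _ cv → Rv v av bv (proj₁ cv , λ e → proj₂ cv (trans e (sym P₁-c)))))

-- Vertices from different pairs

module _ {m} (P : Pairing m) where

  ∃-apart-in : ∀ k {R} → Closed P R → ∣ R ∣ₛ ≡ 2 * suc k →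
    ∃ λ u → R u ≡ true × Closed P (remove P R u) × ∣ remove P R u ∣ₛ ≡ 2 * k
  ∃-apart-in k {R} closed e = let (u , Ru) = ∃-member R (subst (1 ≤_) (sym e) (s≤s z≤n)) in
    u , Ru , remove-closed P u closed , ∣remove∣ P k closed Ru e

∃-apart₂ : ∀ k (P : Pairing (2 * suc (suc k))) → ∃₂ λ u v → Apart P u v
∃-apart₂ k P =
  let (u , _ , cl₁ , e₁) = ∃-apart-in P (suc k) {λ _ → true} (λ _ → refl)
                             (trans (sum-const (2 * suc (suc k)) 1) (*-identityʳ _))
      (v , v∈ , _ , _)   = ∃-apart-in P k cl₁ e₁
  in u , v , remove-apart P (λ _ → true) u v v∈

∃-apart₃ : ∀ k (P : Pairing (2 * suc (suc (suc k)))) →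
           ∃₂ λ u v → ∃ λ w → Apart P u v × Apart P u w × Apart P v w
∃-apart₃ k P =
  let (u , _ , cl₁ , e₁)  = ∃-apart-in P (suc (suc k)) {λ _ → true} (λ _ → refl)
                              (trans (sum-const (2 * suc (suc (suc k))) 1) (*-identityʳ _))
      R₁                  = remove P (λ _ → true) u
      (v , v∈ , cl₂ , e₂) = ∃-apart-in P (suc k) cl₁ e₁
      (w , w∈ , _ , _)    = ∃-apart-in P k cl₂ e₂
  in u , v , w , remove-apart P (λ _ → true) u v v∈
   , remove-apart P (λ _ → true) u w (remove-⊆ P R₁ v w w∈) , remove-apart P R₁ v w w∈

-- Savings from two or three matching edges

module Savings {n} (G : Graph (2 * n)) (P : Pairing (2 * n)) (P-in : Within (adj G) P)
               {S : Rel₂ (2 * n)} (gfS : GfSet G S) where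

  private
    m = 2 * n

    infix 9 _′
    _′ : Fin m → Fin m
    v ′ = mate P v

  K : Rel₂ m
  K = delete (adj G) S

  K-sym : ∀ {u v b} → K u v ≡ b → K v u ≡ b
  K-sym {u} {v} e = trans (delete-sym (adj-sym G) (proj₁ gfS) v u) e

  K⇒¬S : ∀ {u v} {B : Set} → K u v ≡ true → S u v ≡ true → B
  K⇒¬S {u} {v} k s = true≢false s (not-true (∧-trueʳ {adj G u v} k))

  within : (v w : Fin m) → Set
  within v w = adj G v w ≡ true

  within-sym : ∀ {v w} → within v w → within w v
  within-sym {v} {w} e = trans (adj-sym G w v) e

  -- Otherwise both other matchings of {u, u′, v, v′} miss S.
  ∃-deficient : ∀ {u v} → Apart P u v → ∃₂ λ x y → (x ≡ u ⊎ x ≡ u ′) × (y ≡ v ⊎ y ≡ v ′) × K x y ≡ false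
  ∃-deficient {u} {v} uv
    with true⊎false (K u v) | true⊎false (K u (v ′)) | true⊎false (K (u ′) v) | true⊎false (K (u ′) (v ′))
  ... | inj₂ k | _ | _ | _ = u , v , inj₁ refl , inj₁ refl , k
  ... | _ | inj₂ k | _ | _ = u , v ′ , inj₁ refl , inj₂ refl , k
  ... | _ | _ | inj₂ k | _ = u ′ , v , inj₂ refl , inj₁ refl , k
  ... | _ | _ | _ | inj₂ k = u ′ , v ′ , inj₂ refl , inj₂ refl , k
  ... | inj₁ k₁ | inj₁ k₂ | inj₁ k₃ | inj₁ k₄ = contradiction
        (trans (sym (rewire-at P u v uv)) (trans (GfSet⇒mate-≡ G gfS Q₁ Q₂ in₁ in₂ k₁₂ k₂₁ u) (rewire-at P u (v ′) uv′)))
        (mate-≢ P v ∘ sym)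
    where
    uv′ = apart-mateʳ P uv
    Q₁ = rewire P u v
    Q₂ = rewire P u (v ′)
    k₃′ : K (u ′) (v ′ ′) ≡ true
    k₃′ = trans (cong (K (u ′)) (mate-mate P v)) k₃

    in₁ : Within (adj G) Q₁
    in₁ = rewire-elim P u v uv within (∧-trueˡ k₁) (within-sym (∧-trueˡ k₁)) (∧-trueˡ k₄) (within-sym (∧-trueˡ k₄))
            (λ w _ _ → P-in w)

    in₂ : Within (adj G) Q₂
    in₂ = rewire-elim P u (v ′) uv′ within (∧-trueˡ k₂) (within-sym (∧-trueˡ k₂)) (∧-trueˡ k₃′) (within-sym (∧-trueˡ k₃′))
            (λ w _ _ → P-in w)

    k₁₂ : KeepsOn S Q₁ Q₂
    k₁₂ = rewire-elim P u v uv (λ x y → S x y ≡ true → mate Q₂ x ≡ y)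
            (K⇒¬S k₁) (K⇒¬S (K-sym k₁)) (K⇒¬S k₄) (K⇒¬S (K-sym k₄))
            (λ w uw vw _ → rewire-other P u (v ′) uv′ uw (apart-mateˡ P vw))

    k₂₁ : KeepsOn S Q₂ Q₁
    k₂₁ = rewire-elim P u (v ′) uv′ (λ x y → S x y ≡ true → mate Q₁ x ≡ y)
            (K⇒¬S k₂) (K⇒¬S (K-sym k₂)) (K⇒¬S k₃′) (K⇒¬S (K-sym k₃′))
            (λ w uw v′w _ → rewire-other P u v uv uw (subst (λ z → Apart P z w) (mate-mate P v) (apart-mateˡ P v′w)))

  private
    keeps : ∀ Q Q* → (∀ v → K v (mate Q v) ≡ true ⊎ mate Q* v ≡ mate Q v) → KeepsOn S Q Q*
    keeps Q Q* h v s = [ (λ k → K⇒¬S k s) , id ]′ (h v)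

    same-or-mate : ∀ {u x y} → x ≡ u ⊎ x ≡ u ′ → y ≡ u ⊎ y ≡ u ′ → x ≡ y ⊎ y ≡ x ′
    same-or-mate (inj₁ refl) (inj₁ refl) = inj₁ refl
    same-or-mate (inj₁ refl) (inj₂ refl) = inj₂ refl
    same-or-mate (inj₂ refl) (inj₁ refl) = inj₂ (sym (mate-mate P _))
    same-or-mate (inj₂ refl) (inj₂ refl) = inj₁ refl

    spread : ∀ {u v x y} → Apart P u v → x ≡ u ⊎ x ≡ u ′ → y ≡ v ⊎ y ≡ v ′ → Apart P x y
    spread uv (inj₁ refl) (inj₁ refl) = uv
    spread uv (inj₁ refl) (inj₂ refl) = apart-mateʳ P uv
    spread uv (inj₂ refl) (inj₁ refl) = apart-mateˡ P uv
    spread uv (inj₂ refl) (inj₂ refl) = apart-mateˡ P (apart-mateʳ P uv)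

  -- Savings are counted over ordered pairs, so one saved edge contributes 2.
  Saves : ℕ → Set
  Saves k = ∃ λ A → Labelling P A × k ≤ sum₂ (saved G S A)

  private
    row : ∀ {A u v} → A u ≡ true → A v ≡ true → v ≢ u → K u v ≡ false → 1 ≤ sum (saved G S A u)
    row {A} {u} {v} Au Av v≢u k = ≤-trans (≤-reflexive (sym one)) (term≤sum (saved G S A u) v)
      where
      one : saved G S A u v ≡ 1
      one rewrite Au | Av | ≢⇒==-false v≢u | k = refl

  edge-saves : ∀ {u v} → Apart P u v → K u v ≡ false → Saves 2
  edge-saves {u} {v} uv k = let (A , A-P , Au , Av) = ∃-labelling₂ P uv in
    A , A-P , length≤sum _ ((proj₁ uv ∘ sym ∷ []) ∷ [] ∷ [])
      (row {A} Au Av (proj₁ uv) k ∷ row {A} Av Au (proj₁ uv ∘ sym) (K-sym k) ∷ [])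

  -- The rows of `u`, `v` and `w` each contain a saved pair once all three vertices are in `A`.
  -- Three is enough: it exceeds by one the saving that any two matching edges give.
  star-saves : ∀ {u v w} → Apart P u v → Apart P u w → Apart P v w → K u v ≡ false → K u w ≡ false → Saves 3
  star-saves {u} {v} {w} uv uw vw k l = let (A , A-P , Au , Av , Aw) = ∃-labelling₃ P uv uw vw in
    A , A-P , length≤sum _ ((proj₁ uv ∘ sym ∷ proj₁ uw ∘ sym ∷ []) ∷ (proj₁ vw ∘ sym ∷ []) ∷ [] ∷ [])
      (row {A} Au Av (proj₁ uv) k ∷ row {A} Av Au (proj₁ uv ∘ sym) (K-sym k)
        ∷ row {A} Aw Au (proj₁ uw ∘ sym) (K-sym l) ∷ [])

  -- The two hexagon matchings p′q, q′r′, rp and p′q′, qr, r′p cannot both miss S, and any edge of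
  -- theirs outside K shares an endpoint with one of the three given ones.
  triangle-saves : ∀ {p q r} → Apart P p q → Apart P p r → Apart P q r →
    K p q ≡ false → K (q ′) r ≡ false → K (r ′) (p ′) ≡ false → Saves 3
  triangle-saves {p} {q} {r} pq pr qr k₁ k₂ k₃
    with true⊎false (K (p ′) q) | true⊎false (K (q ′) (r ′)) | true⊎false (K p r)
       | true⊎false (K (p ′) (q ′)) | true⊎false (K q r) | true⊎false (K p (r ′))
  ... | inj₂ k | _ | _ | _ | _ | _ = star-saves p′q p′r′ (apart-mateʳ P qr) k (K-sym k₃)
    where p′q = apart-mateˡ P pq
          p′r′ = apart-mateˡ P (apart-mateʳ P pr)
  ... | _ | inj₂ k | _ | _ | _ | _ = star-saves (apart-sym P q′r′) (apart-sym P p′r′) (apart-sym P p′q′) (K-sym k) k₃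
    where p′q′ = apart-mateˡ P (apart-mateʳ P pq)
          p′r′ = apart-mateˡ P (apart-mateʳ P pr)
          q′r′ = apart-mateˡ P (apart-mateʳ P qr)
  ... | _ | _ | inj₂ k | _ | _ | _ = star-saves pr pq (apart-sym P qr) k k₁
  ... | _ | _ | _ | inj₂ k | _ | _ = star-saves p′q′ p′r′ q′r′ k (K-sym k₃)
    where p′q′ = apart-mateˡ P (apart-mateʳ P pq)
          p′r′ = apart-mateˡ P (apart-mateʳ P pr)
          q′r′ = apart-mateˡ P (apart-mateʳ P qr)
  ... | _ | _ | _ | _ | inj₂ k | _ = star-saves qr (apart-sym P pq) (apart-sym P pr) k (K-sym k₁)
  ... | _ | _ | _ | _ | _ | inj₂ k = star-saves pq (apart-mateʳ P pr) (apart-mateʳ P qr) k₁ k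
  ... | inj₁ e₁ | inj₁ e₂ | inj₁ e₃ | inj₁ f₁ | inj₁ f₂ | inj₁ f₃ = contradiction
        (trans (sym (hexagon-at P p′q p′r′ qr′))
          (trans (GfSet⇒mate-≡ G gfS Q₁ Q₂ in₁ in₂ k₁₂ k₂₁ (p ′)) (hexagon-at P p′q′ p′r q′r)))
        (mate-≢ P q ∘ sym)
    where
    p′q  = apart-mateˡ P pq
    p′q′ = apart-mateʳ P p′q
    p′r  = apart-mateˡ P pr
    p′r′ = apart-mateʳ P p′r
    qr′  = apart-mateʳ P qr
    q′r  = apart-mateˡ P qr
    Q₁ = hexagon P p′q p′r′ qr′
    Q₂ = hexagon P p′q′ p′r q′r

    e₃′ : K (p ′ ′) (r ′ ′) ≡ true
    e₃′ = trans (cong₂ K (mate-mate P p) (mate-mate P r)) e₃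

    f₂′ : K (q ′ ′) r ≡ true
    f₂′ = trans (cong (λ z → K z r) (mate-mate P q)) f₂

    f₃′ : K (p ′ ′) (r ′) ≡ true
    f₃′ = trans (cong (λ z → K z (r ′)) (mate-mate P p)) f₃

    in₁ : Within (adj G) Q₁
    in₁ = hexagon-elim P p′q p′r′ qr′ within within-sym (∧-trueˡ e₁) (∧-trueˡ e₂) (∧-trueˡ e₃′) (λ v _ _ _ → P-in v)

    in₂ : Within (adj G) Q₂
    in₂ = hexagon-elim P p′q′ p′r q′r within within-sym (∧-trueˡ f₁) (∧-trueˡ f₂′) (∧-trueˡ f₃′) (λ v _ _ _ → P-in v)

    unprime : ∀ {u v} → Apart P (u ′) v → Apart P u v
    unprime {u} {v} ap = subst (λ z → Apart P z v) (mate-mate P u) (apart-mateˡ P ap)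

    R-sym : ∀ Q {x y} → K x y ≡ true ⊎ mate Q x ≡ y → K y x ≡ true ⊎ mate Q y ≡ x
    R-sym Q = [ inj₁ ∘ K-sym , inj₂ ∘ mate-swap Q ]′

    k₁₂ : KeepsOn S Q₁ Q₂
    k₁₂ = keeps Q₁ Q₂ (hexagon-elim P p′q p′r′ qr′ (λ x y → K x y ≡ true ⊎ mate Q₂ x ≡ y) (R-sym Q₂)
      (inj₁ e₁) (inj₁ e₂) (inj₁ e₃′)
      (λ w p′w qw r′w → inj₂ (hexagon-other P p′q′ p′r q′r p′w (apart-mateˡ P qw) (unprime r′w))))

    k₂₁ : KeepsOn S Q₂ Q₁
    k₂₁ = keeps Q₂ Q₁ (hexagon-elim P p′q′ p′r q′r (λ x y → K x y ≡ true ⊎ mate Q₁ x ≡ y) (R-sym Q₁)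
      (inj₁ f₁) (inj₁ f₂′) (inj₁ f₃′)
      (λ w p′w q′w rw → inj₂ (hexagon-other P p′q p′r′ qr′ p′w (unprime q′w) (apart-mateˡ P rw))))

  two-apart-save : ∀ {u v} → Apart P u v → Saves 2
  two-apart-save uv = let (x , y , x∈ , y∈ , k) = ∃-deficient uv in edge-saves (spread uv x∈ y∈) k

  -- Any two of the three matching edges have a deficient pair between them. If two of these pairs
  -- meet in a vertex they form a star; otherwise they use all six ends, which is the configuration
  -- of `triangle-saves`.
  three-apart-save : ∀ {u v w} → Apart P u v → Apart P u w → Apart P v w → Saves 3
  three-apart-save {u} {v} {w} uv uw vw
    with ∃-deficient uv | ∃-deficient vw | ∃-deficient (apart-sym P uw)
  ... | x₁ , x₂ , x₁∈ , x₂∈ , k₁ | y₂ , y₃ , y₂∈ , y₃∈ , k₂ | z₃ , z₁ , z₃∈ , z₁∈ , k₃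
    with same-or-mate x₂∈ y₂∈ | same-or-mate y₃∈ z₃∈ | same-or-mate x₁∈ z₁∈
  ... | inj₁ refl | _ | _ = star-saves (apart-sym P (spread uv x₁∈ x₂∈)) (spread vw y₂∈ y₃∈) (spread uw x₁∈ y₃∈) (K-sym k₁) k₂
  ... | _ | inj₁ refl | _ = star-saves (apart-sym P (spread vw y₂∈ y₃∈)) (apart-sym P (spread uw z₁∈ y₃∈))
                              (apart-sym P (spread uv z₁∈ y₂∈)) (K-sym k₂) k₃
  ... | _ | _ | inj₁ refl = star-saves (spread uv x₁∈ x₂∈) (spread uw x₁∈ z₃∈) (spread vw x₂∈ z₃∈) k₁ (K-sym k₃)
  ... | inj₂ refl | inj₂ refl | inj₂ refl =
    triangle-saves (spread uv x₁∈ x₂∈) (spread uw x₁∈ y₃∈) (spread vw x₂∈ y₃∈) k₁ k₂ k₃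

-- Bounding the anti-forcing number of a matching

module _ {n} (G : Graph (2 * n)) {M : Rel₂ (2 * n)} (M-pm : IsPM (adj G) M) {S : Rel₂ (2 * n)} (gfS : GfSet G S)
         {a : ℕ} (af : IsAf G M a) where

  private
    P : Pairing (2 * n)
    P = IsPM⇒Pairing (adj-irrefl G) M-pm

    module Sav = Savings {n} G P (IsPM⇒Within (adj-irrefl G) M-pm) gfS

  af-bound : ∀ {k} → Sav.Saves k → 2 * a + k + n ≤ 2 * size S + n * n
  af-bound {k} (A , A-P , k≤) = let (D , D-af , bound) = ∃-AfSet {n} G M-pm gfS A-P in
    ≤-trans (+-monoˡ-≤ n (+-mono-≤ (*-monoʳ-≤ 2 (proj₂ af D D-af)) k≤)) bound

af-bound₂ : ∀ k (G : Graph (2 * suc (suc k))) {M S a} → IsPM (adj G) M → GfSet G S → IsAf G M a →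
            2 * a + 2 + suc (suc k) ≤ 2 * size S + suc (suc k) * suc (suc k)
af-bound₂ k G M-pm gfS af =
  let P = IsPM⇒Pairing (adj-irrefl G) M-pm ; (u , v , uv) = ∃-apart₂ k P in
  af-bound {suc (suc k)} G M-pm gfS af
    (Savings.two-apart-save {suc (suc k)} G P (IsPM⇒Within (adj-irrefl G) M-pm) gfS uv)

af-bound₃ : ∀ k (G : Graph (2 * suc (suc (suc k)))) {M S a} → IsPM (adj G) M → GfSet G S → IsAf G M a →
            2 * a + 3 + suc (suc (suc k)) ≤ 2 * size S + suc (suc (suc k)) * suc (suc (suc k))
af-bound₃ k G M-pm gfS af =
  let P = IsPM⇒Pairing (adj-irrefl G) M-pm ; (u , v , w , uv , uw , vw) = ∃-apart₃ k P in
  af-bound {suc (suc (suc k))} G M-pm gfS af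
    (Savings.three-apart-save {suc (suc (suc k))} G P (IsPM⇒Within (adj-irrefl G) M-pm) gfS uv uw vw)

open import Data.Integer using (ℤ; +_; -_; _-_; +≤+) renaming (_+_ to _+ℤ_; _*_ to _*ℤ_; _≤_ to _≤ℤ_)
import Data.Integer.Properties as ℤ
import Data.Integer.Solver as ℤ

≤-+⇒-≤ : ∀ g a b → g ≤ a + b → + g - + a ≤ℤ + b
≤-+⇒-≤ g a b h = ℤ.≤-trans (ℤ.+-monoˡ-≤ (- + a) (+≤+ h)) (ℤ.≤-reflexive (trans
  (cong (_- + a) (ℤ.pos-+ a b)) (solve 2 (λ a b → a :+ b :- a := b) refl (+ a) (+ b))))
  where open ℤ.+-*-Solver

-- From ℕ to ℤ

cancelʳ-≤ : ∀ {i j} k → i +ℤ k ≤ℤ j +ℤ k → i ≤ℤ j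
cancelʳ-≤ {i} {j} k h = subst₂ _≤ℤ_ (undo i) (undo j) (ℤ.+-monoˡ-≤ (- k) h)
  where
  open ℤ.+-*-Solver
  undo : ∀ i → i +ℤ k - k ≡ i
  undo i = solve 2 (λ i k → i :+ k :- k := i) refl i k

-- At `n = 2` both bounds on the difference are 0, which forces `g ≡ a`.
equal-at-two : ∀ g a → g ≤ a + 0 → 2 * a + 2 + 2 ≤ 2 * g + 4 → + 2 *ℤ (+ g - + a) ≡ + 0
equal-at-two g a upper lower = cong (+ 2 *ℤ_) (ℤ.i≡j⇒i-j≡0 (cong +_ (≤-antisym
  (subst (g ≤_) (+-identityʳ a) upper)
  (*-cancelˡ-≤ 2 (+-cancelʳ-≤ 4 (2 * a) (2 * g) (subst (_≤ 2 * g + 4) (+-assoc (2 * a) 2 2) lower))))))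

module _ (g a n : ℕ) where

  private
    lhs rhs : ℤ
    lhs = - (+ (n * n) - + n - + 2)
    rhs = + 2 *ℤ (+ g - + a)

    -- Adding `2a + n²` to both sides removes all negative terms, so the claims become statements
    -- about natural numbers.
    shift : ℤ
    shift = + 2 *ℤ + a +ℤ + (n * n)

    lhs-shift : lhs +ℤ shift ≡ + (2 * a + 2 + n)
    lhs-shift = trans (solve 3 (λ N n a → :- (N :- n :- con (+ 2)) :+ (con (+ 2) :* a :+ N)
                                   := con (+ 2) :* a :+ con (+ 2) :+ n) refl (+ (n * n)) (+ n) (+ a))
      (sym (trans (ℤ.pos-+ (2 * a + 2) n) (cong (_+ℤ + n) (trans (ℤ.pos-+ (2 * a) 2) (cong (_+ℤ + 2) (ℤ.pos-* 2 a))))))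
      where open ℤ.+-*-Solver

    rhs-shift : rhs +ℤ shift ≡ + (2 * g + n * n)
    rhs-shift = trans (solve 3 (λ N g a → con (+ 2) :* (g :- a) :+ (con (+ 2) :* a :+ N)
                                   := con (+ 2) :* g :+ N) refl (+ (n * n)) (+ g) (+ a))
      (sym (trans (ℤ.pos-+ (2 * g) (n * n)) (cong (_+ℤ + (n * n)) (ℤ.pos-* 2 g))))
      where open ℤ.+-*-Solver

  lower-bound : 2 * a + 2 + n ≤ 2 * g + n * n → lhs ≤ℤ rhs
  lower-bound h = cancelʳ-≤ shift (subst₂ _≤ℤ_ (sym lhs-shift) (sym rhs-shift) (+≤+ h))

  equality : rhs ≡ lhs → 2 * g + n * n ≡ 2 * a + 2 + n
  equality e = ℤ.+-injective (trans (sym rhs-shift) (trans (cong (_+ℤ shift) e) lhs-shift))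

theorem5p2 : (n : ℕ) → 2 ≤ n → (G : Graph (2 * n)) → Connected G → HasPM G →
    (gf Af : ℕ) → IsGf G gf → IsAfMax G Af →
    ((- (+ (n * n) - + n - + 2)) ≤ℤ (+ 2) *ℤ (+ gf - + Af)
    × (+ gf - + Af) ≤ℤ ((+ n - + 1) *ℤ (+ n - + 2)))
    × (((+ 2) *ℤ (+ gf - + Af) ≡ - (+ (n * n) - + n - + 2)) ⇔ (n ≡ 2))
theorem5p2 (suc (suc k)) (s≤s (s≤s z≤n)) G _ _ gf Af isGf@((S , gfS , refl) , _) ((M , M-pm , af@((T , afT , refl) , _)) , _) =
  -- Both bounds are read off at the matching `M` where `Af` is attained, from its minimum
  -- anti-forcing set `T` and a minimum global forcing set `S`.
  (lower-bound gf Af (suc (suc k)) (af-bound₂ k G M-pm gfS af)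
    -- With `n = k + 2` the factors `n − 1` and `n − 2` compute to `suc k` and `k`.
    , subst (+ gf - + Af ≤ℤ_) (ℤ.pos-* (suc k) k) (≤-+⇒-≤ gf Af (suc k * k) upper))
  , mk⇔ (λ e → only-if k G M-pm gfS af (equality gf Af (suc (suc k)) e)) (λ { refl → equal-at-two gf Af upper (af-bound₂ 0 G M-pm gfS af) })
  where
  upper : gf ≤ Af + suc k * k
  upper = gf≤size-AfSet {k = suc k} G afT isGf

  -- From `n = 3` on, the third unit saved makes the lower bound strict, so equality would put a
  -- number below itself.
  only-if : ∀ k (G : Graph (2 * suc (suc k))) {M S a} → IsPM (adj G) M → GfSet G S → IsAf G M a →
            2 * size S + suc (suc k) * suc (suc k) ≡ 2 * a + 2 + suc (suc k) → suc (suc k) ≡ 2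
  only-if zero _ _ _ _ _ = refl
  only-if (suc k) G {a = a} M-pm gfS af e = contradiction
    (subst₂ _≤_ (cong (_+ suc (suc (suc k))) (+-suc (2 * a) 2)) e (af-bound₃ k G M-pm gfS af)) (<-irrefl refl)
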